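{- Let $\mathcal G,\mathcal H$ be computably enumerable classes of graphs. If $\mathcal G\preceq\mathcal H$, then $p\text{ - }\mathrm{HOM}(\mathcal G^*)\le_{\mathit{qfap}}p\text{ - }\mathrm{HOM}(\mathcal H^*)$.
   Context: Graphs are finite, simple, undirected, with non-empty vertex set, viewed as $\{E\}$-structures; $\mathrm{refl}(E^{\mathbf G})=E^{\mathbf G}\cup\{(g,g)\mid g\in G\}$. An $\mathbf H$-deconstruction of $\mathbf G$ is a family $(B_h)_{h\in H}$ of subsets of $G$ such that (Coverage) for each $(g,g')\in\mathrm{refl}(E^{\mathbf G})$ there is $(h,h')\in\mathrm{refl}(E^{\mathbf H})$ with $\{g,g'\}\subseteq B_h\cup B_{h'}$, and (Connectivity) for each $g\in G$ the set $\{h\mid g\in B_h\}$ is connected in $\mathbf H$; its width is $\max_{(h,h')\in\mathrm{refl}(E^{\mathbf H})}|B_h\cup B_{h'}|$. $\mathcal G\preceq\mathcal H$ means there is $k\ge 1$ such that every $\mathbf G\in\mathcal G$ has an $\mathbf H$-deconstruction of width $\le k$ for some $\mathbf H\in\mathcal H$. Structures are finite, relational, over finite vocabularies, with non-empty universe; $\mathrm{STR}[\tau]$ is the class of $\tau$-structures and $\mathrm{STR}$ that of all structures. Similar structures are those over the same vocabulary; $\mathbf A\to\mathbf B$ means there is a homomorphism between similar structures. $\mathbf A^*$ expands $\mathbf A$ by a new unary symbol $C_a$ interpreted by $\{a\}$, for each $a\in A$; $\mathcal A^*=\{\mathbf A^*\mid\mathbf A\in\mathcal A\}$. $\ulcorner\mathbf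 A\urcorner\in\mathbb N$ is a natural code of $\mathbf A$, and $p\text{ - }\mathrm{HOM}(\mathcal A)=\{(\mathbf B,\ulcorner\mathbf A\urcorner)\mid \mathbf A\in\mathcal A,\ \mathbf A\to\mathbf B\}$. Interpretations. Let $U\notin\tau$ be a unary relation symbol. A quantifier-free interpretation of $\tau$ in $\sigma$ of dimension $w$ is a sequence $I=(\varphi_R)_{R\in\tau\cup\{U,=\}}$ of quantifier-free first-order $\sigma$-formulas, where $\varphi_R=\varphi_R(\bar x_1,\ldots,\bar x_{\mathrm{ar}(R)})$ and $\varphi_= =\varphi_=(\bar x_1,\bar x_2)$ with each $\bar x_i$ a $w$-tuple of variables. For a $\sigma$-structure $\mathbf A$, $I(\mathbf A)$ is the (unique up to isomorphism) $\tau$-structure $\mathbf B$, if it exists, for which there is a surjection $f:\varphi_U(\mathbf A)\to B$ such that for all $\bar a_i\in\varphi_U(\mathbf A)=\{\bar a\in A^w\mid\mathbf A\models\varphi_U(\bar a)\}$: $\mathbf A\models\varphi_=(\bar a_1,\bar a_2)\iff f(\bar a_1)=f(\bar a_2)$, and $\mathbf A\models\varphi_R(\bar a_1,\ldots,\bar a_{\mathrm{ar}(R)})\iff(f(\bar a_1),\ldots,f(\bar a_{\mathrm{ar}(R)}))\in R^{\mathbf B}$ for $R\in\tau$. In addition, $I(\mathbf A):=\emptyset$ if $\varphi_U(\mathbf A)=\emptyset$, and $I(\emptyset):=\emptyset$. Otherwise $I$ is undefined on $\mathbf A$. $\langle\mathbf A,\mathbf B\rangle$ denotes the disjoint union of $\mathbf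 A$ and $\mathbf B$ (over the union of their vocabularies) expanded by two new unary symbols $P_1,P_2$ interpreted by the copies of $A$ and $B$, respectively. Reductions. A parameterized problem is a set $Q\subseteq\mathrm{STR}\times\mathbb N$ such that for each $k$ the slice $\{\mathbf A\mid(\mathbf A,k)\in Q\}$ is an isomorphism-closed class of $\tau_k$-structures for some vocabulary $\tau_k$. A pair $(\emptyset,k)$ counts as a "no" instance of every parameterized problem. $Q\le_{\mathit{qfap}}Q'$ means there are $w\in\mathbb N$ and computable functions $p:\mathbb N\to\mathbb N$, $a:\mathbb N\to\mathrm{STR}$, and $d$ mapping each $k\in\mathbb N$ to a quantifier-free interpretation $d(k)$ of dimension $w$, such that for all $k$ and all $\mathbf A\in\mathrm{STR}[\tau_k]$: $d(k)$ is defined on $\langle a(k),\mathbf A\rangle$, and $(\mathbf A,k)\in Q\iff(d(k)(\langle a(k),\mathbf A\rangle),p(k))\in Q'$. Convention: for a not necessarily decidable class $\mathcal A$, $p\text{ - }\mathrm{HOM}(\mathcal A)\le_{\mathit{qfap}}Q$ means that there are such $w$ and partially computable $p,a,d$ whose domains contain $\{\ulcorner\mathbf A\urcorner\mid\mathbf A\in\mathcal A\}$, such that for all $\mathbf A\in\mathcal A$ and all $\mathbf B$ similar to $\mathbf A$, $\mathbf B':=d(\ulcorner\mathbf A\urcorner)(\langle a(\ulcorner\mathbf A\urcorner),\mathbf B\rangle)$ is defined and $\mathbf A\to\mathbf B\iff(\mathbf B',p(\ulcorner\mathbf A\urcorner))\in Q$. -}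

module Defs where

open import Data.Bool using (Bool; true; false; T; T?; not; _∧_; _∨_; if_then_else_)
open import Data.Empty using (⊥)
open import Data.Fin using (Fin; toℕ; splitAt)
import Data.Fin as Fin
open import Data.Fin.Subset using (Subset; _∪_; ∣_∣)
import Data.Fin.Subset as Subset
open import Data.List using (List; []; _∷_; _++_; map; foldr; filter; cartesianProduct; allFin)
open import Data.List.Extrema.Nat using (max)
import Data.List.Membership.DecPropositional as DecMembership
open import Data.List.Membership.Propositional using (_∈_; mapWith∈)
open import Data.Maybe using (Maybe; just; nothing; maybe′; is-just)
import Data.Maybe.Effectful as Maybe
open import Data.Nat using (ℕ; zero; suc; _+_; _≤_; _<_; _⊔_; _≡ᵇ_; NonZero; >-nonZero; >-nonZero⁻¹)
import Data.Nat as ℕ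
open import Data.Nat.Properties using (m≤m+n; ≤-trans)
open import Data.Product using (Σ; Σ-syntax; ∃; ∃-syntax; _×_; _,_; proj₁; proj₂; uncurry)
open import Data.Product.Properties using (≡-dec)
open import Data.Sum using (_⊎_; isInj₁; isInj₂)
open import Data.Vec using (Vec; []; _∷_; lookup; toList; tabulate)
import Data.Vec as Vec
import Data.Vec.Effectful as VecEffectful
open import Function.Bundles using (_⇔_)
open import Function.Definitions using (Surjective)
open import Level using (0ℓ)
open import Relation.Binary.Construct.Closure.ReflexiveTransitive using (Star)
open import Relation.Binary.PropositionalEquality using (_≡_)
open import Relation.Nullary using (¬_; Dec; yes; no; does)
open import Relation.Nullary.Decidable using (_⊎-dec_)
open import Relation.Unary using (Pred; Empty)

open VecEffectful.TraversableA (Maybe.applicative {0ℓ}) using (mapA)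

------------------------------------------------------------------------
-- Computability on ℕ

triangle : ℕ → ℕ
triangle zero    = 0
triangle (suc n) = suc n + triangle n

-- Cantor's pairing function, a bijection ℕ × ℕ → ℕ.
pair : ℕ → ℕ → ℕ
pair x y = triangle (x + y) + y

-- The partial recursive functions in unary form: arguments are packed with
-- the bijection `pair`, so projections and pairing are initial functions.
data Prog : Set where
  zeroᵖ succᵖ fstᵖ sndᵖ : Prog
  pairᵖ compᵖ recᵖ      : Prog → Prog → Prog
  minᵖ                  : Prog → Prog

infix 4 _⟨_⟩⇓_

-- e ⟨ x ⟩⇓ y : the partial function of e is defined at x, with value y.
data _⟨_⟩⇓_ : Prog → ℕ → ℕ → Set where
  zero⇓  : ∀ {x} → zeroᵖ ⟨ x ⟩⇓ 0
  succ⇓  : ∀ {x} → succᵖ ⟨ x ⟩⇓ suc x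
  fst⇓   : ∀ {x y} → fstᵖ ⟨ pair x y ⟩⇓ x
  snd⇓   : ∀ {x y} → sndᵖ ⟨ pair x y ⟩⇓ y
  pair⇓  : ∀ {f g x y z} → f ⟨ x ⟩⇓ y → g ⟨ x ⟩⇓ z → pairᵖ f g ⟨ x ⟩⇓ pair y z
  comp⇓  : ∀ {f g x y z} → g ⟨ x ⟩⇓ y → f ⟨ y ⟩⇓ z → compᵖ f g ⟨ x ⟩⇓ z
  rec₀⇓  : ∀ {f g x y} → f ⟨ x ⟩⇓ y → recᵖ f g ⟨ pair x 0 ⟩⇓ y
  recₛ⇓  : ∀ {f g x n y z} → recᵖ f g ⟨ pair x n ⟩⇓ y → g ⟨ pair x (pair n y) ⟩⇓ z →
           recᵖ f g ⟨ pair x (suc n) ⟩⇓ z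
  min⇓   : ∀ {f x n} → f ⟨ pair x n ⟩⇓ 0 →
           (∀ m → m < n → ∃[ y ] f ⟨ pair x m ⟩⇓ suc y) →
           minᵖ f ⟨ x ⟩⇓ n

-- Empty, or the range of a total computable function.
ComputablyEnumerable : Pred ℕ 0ℓ → Set
ComputablyEnumerable X =
  Empty X ⊎
  Σ[ e ∈ Prog ] (∀ n → ∃[ x ] (e ⟨ n ⟩⇓ x × X x)) × (∀ x → X x → ∃[ n ] e ⟨ n ⟩⇓ x)

image : {A B : Set} → (A → B) → Pred A 0ℓ → Pred B 0ℓ
image f P y = ∃[ x ] (P x × y ≡ f x)

encList : List ℕ → ℕ
encList = foldr (λ x c → suc (pair x c)) 0

------------------------------------------------------------------------
-- Vocabularies and structures

-- A relation symbol is given by its name and its arity.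
Symbol : Set
Symbol = ℕ × ℕ

name arity : Symbol → ℕ
name  = proj₁
arity = proj₂

-- A list presenting a finite set of symbols.
Vocabulary : Set
Vocabulary = List Symbol

open DecMembership (≡-dec ℕ._≟_ ℕ._≟_) using (_∈?_)

-- Every symbol named `fresh τ` or above is outside τ.
fresh : Vocabulary → ℕ
fresh = foldr (λ R m → suc (name R) ⊔ m) 0

-- The universe is {0,…,size-1}.  Membership in τ is an irrelevant argument,
-- so repetitions in the list τ carry no information.
record Structure (τ : Vocabulary) : Set where
  field
    size         : ℕ
    ⦃ nonEmpty ⦄ : NonZero size
    rel          : (R : Symbol) → .(R ∈ τ) → Vec (Fin size) (arity R) → Bool

open Structure public

STR : Set
STR = Σ Vocabulary Structure

_⟦_⟧ : ∀ {τ} (A : Structure τ) (R : Symbol) → Vec (Fin (size A)) (arity R) → Bool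
_⟦_⟧ {τ} A R v with R ∈? τ
... | yes R∈τ = rel A R R∈τ v
... | no  _   = false

infix 4 _⟶_

_⟶_ : ∀ {τ} → Structure τ → Structure τ → Set
_⟶_ {τ} A B =
  Σ[ f ∈ (Fin (size A) → Fin (size B)) ]
    (∀ R (R∈τ : R ∈ τ) v → T (rel A R R∈τ v) → T (rel B R R∈τ (Vec.map f v)))

encSymbol : Symbol → ℕ
encSymbol = uncurry pair

encVocabulary : Vocabulary → ℕ
encVocabulary τ = encList (map encSymbol τ)

-- A k-ary relation is coded as its k-fold nested truth table.
encRelation : ∀ {n} k → (Vec (Fin n) k → Bool) → ℕ
encRelation zero    r = if r [] then 1 else 0
encRelation (suc k) r =
  encList (toList (tabulate λ a → encRelation k (λ v → r (a ∷ v))))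

⌜_⌝ : STR → ℕ
⌜ τ , A ⌝ =
  pair (encVocabulary τ)
    (pair (size A)
      (encList (mapWith∈ τ λ {R} R∈τ → encRelation (arity R) (rel A R R∈τ))))

-- The symbol C_a of the expansion A*, for a the element with index i.
C : Vocabulary → ℕ → Symbol
C τ i = fresh τ + i , 1

starVocabulary : Vocabulary → ℕ → Vocabulary
starVocabulary τ n = τ ++ map (λ a → C τ (toℕ a)) (allFin n)

star : ∀ {τ} (A : Structure τ) → Structure (starVocabulary τ (size A))
star {τ} A = record { size = size A ; rel = λ R _ v → (A ⟦ R ⟧) v ∨ singleton R v }
  where
  singleton : (R : Symbol) → Vec (Fin (size A)) (arity R) → Bool
  singleton (c , 1) (a ∷ []) = c ≡ᵇ fresh τ + toℕ a
  singleton _       _        = false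

starSTR : STR → STR
starSTR (τ , A) = starVocabulary τ (size A) , star A

_✶ : Pred STR 0ℓ → Pred STR 0ℓ
𝒜 ✶ = image starSTR 𝒜

P₁ P₂ : Vocabulary → Symbol
P₁ ρ = fresh ρ , 1
P₂ ρ = suc (fresh ρ) , 1

pairVocabulary : Vocabulary → Vocabulary → Vocabulary
pairVocabulary τ σ = (τ ++ σ) ++ P₁ (τ ++ σ) ∷ P₂ (τ ++ σ) ∷ []

⟨_,_⟩ : ∀ {τ σ} → Structure τ → Structure σ → Structure (pairVocabulary τ σ)
⟨_,_⟩ {τ} {σ} A B = record
  { size     = size A + size B
  ; nonEmpty = >-nonZero (≤-trans (>-nonZero⁻¹ (size A)) (m≤m+n (size A) (size B)))
  ; rel      = λ R _ v → maybe′ (A ⟦ R ⟧) false (mapA left v)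
                       ∨ maybe′ (B ⟦ R ⟧) false (mapA right v)
                       ∨ mark R v
  }
  where
  left : Fin (size A + size B) → Maybe (Fin (size A))
  left x = isInj₁ (splitAt (size A) x)

  right : Fin (size A + size B) → Maybe (Fin (size B))
  right x = isInj₂ (splitAt (size A) x)

  mark : (R : Symbol) → Vec (Fin (size A + size B)) (arity R) → Bool
  mark (c , 1) (x ∷ []) = ((c ≡ᵇ name (P₁ (τ ++ σ))) ∧ is-just (left x))
                        ∨ ((c ≡ᵇ name (P₂ (τ ++ σ))) ∧ is-just (right x))
  mark _       _        = false

------------------------------------------------------------------------
-- Graphs and deconstructions

record Graph : Set where
  field
    order       : ℕ
    ⦃ nonEmpty ⦄ : NonZero order
    adj         : Fin order → Fin order → Bool
    symmetric   : ∀ x y → adj x y ≡ adj y x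
    irreflexive : ∀ x → adj x x ≡ false

open Graph public using (order; adj)

E : Symbol
E = 0 , 2

graphStructure : Graph → STR
graphStructure G = E ∷ [] , record
  { size = order G ; nonEmpty = Graph.nonEmpty G ; rel = λ R _ → edges R }
  where
  edges : (R : Symbol) → Vec (Fin (order G)) (arity R) → Bool
  edges (0 , 2) (x ∷ y ∷ []) = adj G x y
  edges _       _            = false

ComputablyEnumerableGraphs : Pred Graph 0ℓ → Set
ComputablyEnumerableGraphs 𝒢 = ComputablyEnumerable (image (λ G → ⌜ graphStructure G ⌝) 𝒢)

ReflE : (G : Graph) → Fin (order G) → Fin (order G) → Set
ReflE G x y = T (adj G x y) ⊎ x ≡ y

reflE? : (G : Graph) (e : Fin (order G) × Fin (order G)) → Dec (uncurry (ReflE G) e)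
reflE? G (x , y) = T? (adj G x y) ⊎-dec (x Fin.≟ y)

-- Any two elements are joined by a path inside X.  (The empty set is allowed,
-- but coverage excludes it for the sets occurring in deconstructions.)
Connected : (H : Graph) → Pred (Fin (order H)) 0ℓ → Set
Connected H X =
  ∀ {x y} → X x → X y → Star (λ u v → T (adj H u v) × X u × X v) x y

record Deconstruction (H G : Graph) : Set where
  field
    bag          : Fin (order H) → Subset (order G)
    coverage     : ∀ {g g′} → ReflE G g g′ →
                   ∃[ h ] ∃[ h′ ] (ReflE H h h′ ×
                     g Subset.∈ bag h ∪ bag h′ × g′ Subset.∈ bag h ∪ bag h′)
    connectivity : ∀ g → Connected H (λ h → g Subset.∈ bag h)

  width : ℕ
  width = max 0 (map (λ (h , h′) → ∣ bag h ∪ bag h′ ∣)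
                  (filter (reflE? H)
                    (cartesianProduct (allFin (order H)) (allFin (order H)))))

open Deconstruction public

infix 4 _≼_

_≼_ : Pred Graph 0ℓ → Pred Graph 0ℓ → Set
𝒢 ≼ ℋ = ∃[ k ] (1 ≤ k × (∀ G → 𝒢 G → ∃[ H ] (ℋ H × Σ[ D ∈ Deconstruction H G ] width D ≤ k)))

------------------------------------------------------------------------
-- Quantifier-free interpretations

-- Quantifier-free σ-formulas in r tuples of w variables each; the variable
-- (i , j) is the j-th component of the i-th tuple.
data Formula (σ : Vocabulary) (r w : ℕ) : Set where
  atom       : (R : Symbol) → .(R ∈ σ) → Vec (Fin r × Fin w) (arity R) → Formula σ r w
  _≐_        : Fin r × Fin w → Fin r × Fin w → Formula σ r w
  ¬′_        : Formula σ r w → Formula σ r w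
  _∧′_ _∨′_  : Formula σ r w → Formula σ r w → Formula σ r w

⟦_⟧ : ∀ {σ r w} → Formula σ r w → (A : Structure σ) → Vec (Vec (Fin (size A)) w) r → Bool
⟦ φ ⟧ A as = eval φ
  where
  val : _ → Fin (size A)
  val (i , j) = lookup (lookup as i) j

  eval : Formula _ _ _ → Bool
  eval (atom R R∈σ xs) = rel A R R∈σ (Vec.map val xs)
  eval (x ≐ y)         = does (val x Fin.≟ val y)
  eval (¬′ φ)          = not (eval φ)
  eval (φ ∧′ ψ)        = eval φ ∧ eval ψ
  eval (φ ∨′ ψ)        = eval φ ∨ eval ψ

record Interpretation (w : ℕ) (τ σ : Vocabulary) : Set where
  field
    φU : Formula σ 1 w
    φ= : Formula σ 2 w
    φR : (R : Symbol) → .(R ∈ τ) → Formula σ (arity R) w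

open Interpretation public

encVariable : ∀ {r w} → Fin r × Fin w → ℕ
encVariable (i , j) = pair (toℕ i) (toℕ j)

encFormula : ∀ {σ r w} → Formula σ r w → ℕ
encFormula (atom R _ xs) = pair 0 (pair (encSymbol R) (encList (map encVariable (toList xs))))
encFormula (x ≐ y)       = pair 1 (pair (encVariable x) (encVariable y))
encFormula (¬′ φ)        = pair 2 (encFormula φ)
encFormula (φ ∧′ ψ)      = pair 3 (pair (encFormula φ) (encFormula ψ))
encFormula (φ ∨′ ψ)      = pair 4 (pair (encFormula φ) (encFormula ψ))

encInterpretation : ∀ {w τ σ} → Interpretation w τ σ → ℕ
encInterpretation {τ = τ} {σ} I =
  pair (encVocabulary τ) (pair (encVocabulary σ)
    (pair (encFormula (φU I)) (pair (encFormula (φ= I))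
      (encList (mapWith∈ τ λ {R} R∈τ → encFormula (φR I R R∈τ))))))

-- φ_U(A), as a set of w-tuples.
Domain : ∀ {w τ σ} → Interpretation w τ σ → Structure σ → Set
Domain {w} I A = Σ[ a ∈ Vec (Fin (size A)) w ] T (⟦ φU I ⟧ A (a ∷ []))

record Interprets {w τ σ} (I : Interpretation w τ σ) (A : Structure σ) (B : Structure τ) : Set where
  field
    f          : Domain I A → Fin (size B)
    surjective : Surjective _≡_ _≡_ f
    equality   : ∀ a₁ a₂ → T (⟦ φ= I ⟧ A (proj₁ a₁ ∷ proj₁ a₂ ∷ [])) ⇔ (f a₁ ≡ f a₂)
    relations  : ∀ R (R∈τ : R ∈ τ) (as : Vec (Domain I A) (arity R)) →
                 T (⟦ φR I R R∈τ ⟧ A (Vec.map proj₁ as)) ⇔ T (rel B R R∈τ (Vec.map f as))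

-- I is defined on A with value B (up to isomorphism); `nothing` stands for ∅.
_⟪_⟫≃_ : ∀ {w τ σ} → Interpretation w τ σ → Structure σ → Maybe (Structure τ) → Set
I ⟪ A ⟫≃ just B  = Interprets I A B
I ⟪ A ⟫≃ nothing = ¬ Domain I A

------------------------------------------------------------------------
-- Parameterized problems and reductions

Problem : Set₁
Problem = STR → ℕ → Set

Yes : Problem → ∀ {τ} → Maybe (Structure τ) → ℕ → Set
Yes Q (just B) k = Q (_ , B) k
Yes Q nothing  k = ⊥

p-HOM : Pred STR 0ℓ → Problem
p-HOM 𝒜 (τ , B) k = Σ[ A ∈ Structure τ ] (𝒜 (τ , A) × ⌜ τ , A ⌝ ≡ k × (A ⟶ B))

-- p-HOM(𝒜) ≤_qfap Q for a class 𝒜 that need not be decidable.  The programs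
-- p, a, d act on codes; nothing is required of them outside the codes of 𝒜.
p-HOM⟨_⟩≤qfap_ : Pred STR 0ℓ → Problem → Set
p-HOM⟨ 𝒜 ⟩≤qfap Q =
  Σ[ w ∈ ℕ ] Σ[ p ∈ Prog ] Σ[ a ∈ Prog ] Σ[ d ∈ Prog ]
    (∀ {τ} (A : Structure τ) → 𝒜 (τ , A) →
      Σ[ k ∈ ℕ ] Σ[ ρ ∈ Vocabulary ] Σ[ P ∈ Structure ρ ]
      Σ[ υ ∈ Vocabulary ] Σ[ I ∈ Interpretation w υ (pairVocabulary ρ τ) ]
        p ⟨ ⌜ τ , A ⌝ ⟩⇓ k ×
        a ⟨ ⌜ τ , A ⌝ ⟩⇓ ⌜ ρ , P ⌝ ×
        d ⟨ ⌜ τ , A ⌝ ⟩⇓ encInterpretation I ×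
        ((B : Structure τ) →
          Σ[ B′ ∈ Maybe (Structure υ) ]
            (I ⟪ ⟨ P , B ⟩ ⟫≃ B′ × ((A ⟶ B) ⇔ Yes Q B′ k))))

{-# OPTIONS --safe #-}

-- Given G, search for an H in the enumerated class together with a table t h 1, …, t h k of the
-- elements of each bag B_h and certificates that it describes an H-deconstruction of G; such a table
-- exists because bags have at most k elements.  On ⟨ G* , B ⟩, interpret a 2k-tuple
-- (u₁,…,u_k,x₁,…,x_k) as the partial map u_i ↦ x_i.  The symbol C_h holds of the partial
-- homomorphisms from the bag of h to B that respect the symbols C_g, and E holds of two tuples whose
-- union is a partial homomorphism.  A homomorphism from H* then chooses a partial homomorphism for
-- each bag; these agree by connectivity and preserve all edges of G by coverage, so they amount
-- to a homomorphism G* → B.  Since G* itself is the auxiliary structure, the formula for E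
-- depends only on k, and the one for C_h only on |G| and the row t h.
module Submission where

open import Defs
open import Data.Bool using (Bool; true; false; T; T?; not; _∧_; _∨_; if_then_else_)
import Data.Bool.Properties as Bool
open import Data.Empty using (⊥-elim; ⊥-elim-irr)
open import Data.Fin using (Fin; zero; suc; toℕ; fromℕ<; splitAt; _↑ˡ_; _↑ʳ_)
import Data.Fin as Fin
import Data.Fin.Properties as Fin
open import Data.Fin.Subset using (Subset; _∪_; ∣_∣; inside; outside)
import Data.Fin.Subset as Subset
import Data.Fin.Subset.Properties as Subset
open import Data.List using (List; []; _∷_; _++_; map; foldr; length; allFin; applyUpTo; cartesianProduct)
import Data.List as List
import Data.List.Properties as List
open import Data.List.Membership.Propositional using (_∈_; mapWith∈)
open import Data.List.Membership.Propositional.Properties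
open import Data.List.Relation.Unary.Any using (here; there)
import Data.List.Relation.Unary.All as All
open import Data.List.Extrema.Nat using (xs≤max)
open import Data.Maybe using (Maybe; just)
open import Data.Nat using (ℕ; zero; suc; pred; _+_; _*_; _∸_; _^_; _⊔_)
open import Data.Nat using (_≤_; _<_; _≡ᵇ_; z≤n; s≤s; z<s; s<s; s<s⁻¹; >-nonZero⁻¹; _<?_; _≟_)
open import Data.Nat.Properties
open import Data.Product using (Σ; Σ-syntax; ∃; ∃-syntax; _×_; _,_; proj₁; proj₂)
open import Data.Product.Properties using (≡-dec)
open import Data.Sum using (_⊎_; inj₁; inj₂; [_,_]′)
open import Data.Unit using (tt)
open import Data.Vec using (Vec; []; _∷_; lookup; tabulate; here; there)
import Data.Vec as Vec
import Data.Vec.Properties as Vec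
open import Function using (_∘_; id; case_of_)
open import Function.Bundles using (_⇔_; mk⇔; Equivalence)
open import Level using (0ℓ)
open import Relation.Binary.Construct.Closure.ReflexiveTransitive using (Star; ε; _◅_) renaming (map to Star-map)
open import Relation.Binary.Definitions using (tri<; tri≈; tri>)
open import Relation.Binary.PropositionalEquality
open import Relation.Nullary using (¬_; Dec; yes; no; does; contradiction)
open import Relation.Nullary.Decidable using (¬?; _×-dec_; _⊎-dec_)
open import Relation.Unary using (Pred)
import Data.List.Membership.DecPropositional as DecMembership
open DecMembership (≡-dec _≟_ _≟_) using (_∈?_)

-- Cantor pairing is a bijection

-- The search for H is a minimisation, so a candidate has to be checked by a total test, and the
-- tests available here quantify over bounded ranges only. Coverage has this form. Connectivity asks
-- for paths in H, whose codes have no bound given in advance; such a bound is therefore searched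
-- for together with the table. That some member of the class admits a deconstruction only makes the
-- search halt. The first solution may belong to another graph, which is harmless: every enumerated
-- code is that of a member, and the test vouches for the table. The program has to return exactly
-- the code of the interpretation. Hence the codes of the formulas are rewritten as arithmetical
-- expressions in |G|, |H| and the table, and these expressions are then computed. Everything that
-- depends on k alone, including the shape of each conjunction, is fixed in the program.

stepPair : ℕ × ℕ → ℕ × ℕ
stepPair (zero  , y) = suc y , 0
stepPair (suc x , y) = x , suc y

pair-suc : ∀ x y → pair x (suc y) ≡ suc (pair (suc x) y)
pair-suc x y rewrite +-suc x y = +-suc _ y

pair-zero : ∀ y → pair (suc y) 0 ≡ suc (pair 0 y)
pair-zero y rewrite +-identityʳ y | +-identityʳ (y + triangle y) = cong suc (+-comm y (triangle y))

pair-stepPair : ∀ p → pair (proj₁ (stepPair p)) (proj₂ (stepPair p)) ≡ suc (pair (proj₁ p) (proj₂ p))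
pair-stepPair (zero  , y) = pair-zero y
pair-stepPair (suc x , y) = pair-suc x y

-- `unpair n` is reached from (0 , 0) by n steps along the antidiagonals, so no triangular number
-- has to be inverted. It is opaque so that conversion never evaluates it on codes.
opaque
  unpair : ℕ → ℕ × ℕ
  unpair zero    = 0 , 0
  unpair (suc n) = stepPair (unpair n)

  pair-unpair : ∀ n → pair (proj₁ (unpair n)) (proj₂ (unpair n)) ≡ n
  pair-unpair zero    = refl
  pair-unpair (suc n) = trans (pair-stepPair (unpair n)) (cong suc (pair-unpair n))

  unpair-unique : ∀ n x y → pair x y ≡ n → unpair n ≡ (x , y)
  unpair-unique zero    zero    zero    p = refl
  unpair-unique zero    zero    (suc y) ()
  unpair-unique zero    (suc x) y       ()
  unpair-unique (suc n) zero    zero    ()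
  unpair-unique (suc n) (suc x) zero    p =
    cong stepPair (unpair-unique n 0 x (suc-injective (trans (sym (pair-zero x)) p)))
  unpair-unique (suc n) x       (suc y) p =
    cong stepPair (unpair-unique n (suc x) y (suc-injective (trans (sym (pair-suc x y)) p)))

π₁ π₂ : ℕ → ℕ
π₁ n = proj₁ (unpair n)
π₂ n = proj₂ (unpair n)

π₁-pair : ∀ x y → π₁ (pair x y) ≡ x
π₁-pair x y = cong proj₁ (unpair-unique _ x y refl)

π₂-pair : ∀ x y → π₂ (pair x y) ≡ y
π₂-pair x y = cong proj₂ (unpair-unique _ x y refl)

pair-injective : ∀ {a b c d} → pair a b ≡ pair c d → a ≡ c × b ≡ d
pair-injective {a} {b} {c} {d} p =
  trans (sym (π₁-pair a b)) (trans (cong π₁ p) (π₁-pair c d)) ,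
  trans (sym (π₂-pair a b)) (trans (cong π₂ p) (π₂-pair c d))

-- Computable functions and predicates of several arguments

env : ∀ {n} → Vec ℕ n → ℕ
env []      = 0
env (x ∷ ρ) = pair (env ρ) x

record Fn (n : ℕ) : Set where
  field
    fun      : Vec ℕ n → ℕ
    prog     : Prog
    computes : ∀ ρ → prog ⟨ env ρ ⟩⇓ fun ρ

open Fn

idᵖ : Prog
idᵖ = pairᵖ fstᵖ sndᵖ

fst⇓′ : ∀ n → fstᵖ ⟨ n ⟩⇓ π₁ n
fst⇓′ n = subst (fstᵖ ⟨_⟩⇓ π₁ n) (pair-unpair n) (fst⇓ {y = π₂ n})

snd⇓′ : ∀ n → sndᵖ ⟨ n ⟩⇓ π₂ n
snd⇓′ n = subst (sndᵖ ⟨_⟩⇓ π₂ n) (pair-unpair n) (snd⇓ {x = π₁ n})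

id⇓ : ∀ {n} → idᵖ ⟨ n ⟩⇓ n
id⇓ {n} = subst (idᵖ ⟨ n ⟩⇓_) (pair-unpair n) (pair⇓ (fst⇓′ n) (snd⇓′ n))

infix 5 _≗ᶠ_by_

-- Keeps the program but replaces the computed function by an equal expression, so that `fun` of a
-- composite reduces to the intended formula and not to an iteration.
_≗ᶠ_by_ : ∀ {n} (F : Fn n) (f : Vec ℕ n → ℕ) → (∀ ρ → fun F ρ ≡ f ρ) → Fn n
F ≗ᶠ f by eq = record
  { fun = f ; prog = prog F ; computes = λ ρ → subst (prog F ⟨ env ρ ⟩⇓_) (eq ρ) (computes F ρ) }

var : ∀ {n} → Fin n → Fn n
var i = record { fun = λ ρ → lookup ρ i ; prog = get i ; computes = get⇓ i }
  where
  get : ∀ {n} → Fin n → Prog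
  get zero    = sndᵖ
  get (suc i) = compᵖ (get i) fstᵖ

  get⇓ : ∀ {n} (i : Fin n) ρ → get i ⟨ env ρ ⟩⇓ lookup ρ i
  get⇓ zero    (x ∷ ρ) = snd⇓ {x = env ρ}
  get⇓ (suc i) (x ∷ ρ) = comp⇓ (fst⇓ {y = x}) (get⇓ i ρ)

lit : ∀ {n} → ℕ → Fn n
lit m = record { fun = λ _ → m ; prog = numeral m ; computes = λ _ → numeral⇓ m }
  where
  numeral : ℕ → Prog
  numeral zero    = zeroᵖ
  numeral (suc m) = compᵖ succᵖ (numeral m)

  numeral⇓ : ∀ m {x} → numeral m ⟨ x ⟩⇓ m
  numeral⇓ zero    = zero⇓
  numeral⇓ (suc m) = comp⇓ (numeral⇓ m) succ⇓

after : ∀ {n} (f : ℕ → ℕ) e → (∀ x → e ⟨ x ⟩⇓ f x) → Fn n → Fn n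
after f e e⇓ F = record
  { fun      = λ ρ → f (fun F ρ)
  ; prog     = compᵖ e (prog F)
  ; computes = λ ρ → comp⇓ (computes F ρ) (e⇓ (fun F ρ))
  }

sucᶠ π₁ᶠ π₂ᶠ : ∀ {n} → Fn n → Fn n
sucᶠ = after suc succᵖ (λ _ → succ⇓)
π₁ᶠ  = after π₁ fstᵖ fst⇓′
π₂ᶠ  = after π₂ sndᵖ snd⇓′

pairᶠ : ∀ {n} → Fn n → Fn n → Fn n
pairᶠ F G = record
  { fun      = λ ρ → pair (fun F ρ) (fun G ρ)
  ; prog     = pairᵖ (prog F) (prog G)
  ; computes = λ ρ → pair⇓ (computes F ρ) (computes G ρ)
  }

call : ∀ {m n} → Fn m → Vec (Fn n) m → Fn n
call {m} {n} F Gs = record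
  { fun      = λ ρ → fun F (Vec.map (λ G → fun G ρ) Gs)
  ; prog     = compᵖ (prog F) (args Gs)
  ; computes = λ ρ → comp⇓ (args⇓ Gs ρ) (computes F _)
  }
  where
  args : ∀ {m} → Vec (Fn n) m → Prog
  args []       = zeroᵖ
  args (G ∷ Gs) = pairᵖ (args Gs) (prog G)

  args⇓ : ∀ {m} (Gs : Vec (Fn n) m) ρ → args Gs ⟨ env ρ ⟩⇓ env (Vec.map (λ G → fun G ρ) Gs)
  args⇓ []       ρ = zero⇓
  args⇓ (G ∷ Gs) ρ = pair⇓ (args⇓ Gs ρ) (computes G ρ)

wk : ∀ {n} → Fn n → Fn (suc n)
wk F = record
  { fun      = λ ρ → fun F (Vec.tail ρ)
  ; prog     = compᵖ (prog F) fstᵖ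
  ; computes = λ { (x ∷ ρ) → comp⇓ (fst⇓ {y = x}) (computes F ρ) }
  }

iter : {A : Set} → A → (ℕ → A → A) → ℕ → A
iter b s zero    = b
iter b s (suc n) = s n (iter b s n)

recᶠ : ∀ {n} → Fn n → Fn n → Fn (2 + n) → Fn n
recᶠ {n} count base step = record
  { fun      = λ ρ → result ρ (fun count ρ)
  ; prog     = compᵖ (recᵖ (prog base) step′) (pairᵖ idᵖ (prog count))
  ; computes = λ ρ → comp⇓ (pair⇓ id⇓ (computes count ρ)) (loop ρ (fun count ρ))
  }
  where
  result : Vec ℕ n → ℕ → ℕ
  result ρ = iter (fun base ρ) (λ i a → fun step (a ∷ i ∷ ρ))

  -- `recᵖ` passes pair x (pair i a), while `env (a ∷ i ∷ ρ)` is pair (pair x i) a; the inner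
  -- program reassociates.
  step′ : Prog
  step′ = compᵖ (prog step) (pairᵖ (pairᵖ fstᵖ (compᵖ fstᵖ sndᵖ)) (compᵖ sndᵖ sndᵖ))

  loop : ∀ ρ m → recᵖ (prog base) step′ ⟨ pair (env ρ) m ⟩⇓ result ρ m
  loop ρ zero    = rec₀⇓ (computes base ρ)
  loop ρ (suc m) = recₛ⇓ {x = env ρ} (loop ρ m) (comp⇓
    (pair⇓ (pair⇓ (fst⇓ {x = env ρ} {y = pair m a}) (comp⇓ (snd⇓ {x = env ρ}) (fst⇓ {y = a})))
           (comp⇓ (snd⇓ {x = env ρ}) (snd⇓ {x = m})))
    (computes step (a ∷ m ∷ ρ)))
    where a = result ρ m

pattern v0 = zero
pattern v1 = suc zero
pattern v2 = suc (suc zero)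
pattern v3 = suc (suc (suc zero))
pattern v4 = suc v3
pattern v5 = suc v4

predᶠ : Fn 1
predᶠ = recᶠ (var v0) (lit 0) (var v1) ≗ᶠ (λ ρ → pred (lookup ρ v0)) by λ { (x ∷ []) → lemma x }
  where
  lemma : ∀ x → iter 0 (λ i a → i) x ≡ pred x
  lemma zero    = refl
  lemma (suc x) = refl

infixl 6 _+ᶠ_ _∸ᶠ_
infixl 7 _*ᶠ_

_+ᶠ_ _∸ᶠ_ _*ᶠ_ : ∀ {n} → Fn n → Fn n → Fn n
F +ᶠ G = recᶠ G F (sucᶠ (var v0)) ≗ᶠ (λ ρ → fun F ρ + fun G ρ) by λ ρ → lemma _ (fun G ρ)
  where
  lemma : ∀ a b → iter a (λ _ → suc) b ≡ a + b
  lemma a zero    = sym (+-identityʳ a)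
  lemma a (suc b) = trans (cong suc (lemma a b)) (sym (+-suc a b))
F ∸ᶠ G = recᶠ G F (call predᶠ (var v0 ∷ [])) ≗ᶠ (λ ρ → fun F ρ ∸ fun G ρ) by λ ρ → lemma _ (fun G ρ)
  where
  lemma : ∀ a b → iter a (λ _ → pred) b ≡ a ∸ b
  lemma a zero    = refl
  lemma a (suc b) = trans (cong pred (lemma a b)) (pred[m∸n]≡m∸[1+n] a b)
F *ᶠ G = recᶠ G (lit 0) (var v0 +ᶠ wk (wk F)) ≗ᶠ (λ ρ → fun F ρ * fun G ρ) by λ ρ → lemma _ (fun G ρ)
  where
  lemma : ∀ a b → iter 0 (λ _ c → c + a) b ≡ a * b
  lemma a zero    = sym (*-zeroʳ a)
  lemma a (suc b) = trans (cong (_+ a) (lemma a b)) (trans (+-comm (a * b) a) (sym (*-suc a b)))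

-- A decidable predicate is represented by a computable function vanishing exactly on it.
record Test (n : ℕ) : Set₁ where
  field
    holds    : Vec ℕ n → Set
    test     : Fn n
    sound    : ∀ ρ → fun test ρ ≡ 0 → holds ρ
    complete : ∀ ρ → holds ρ → fun test ρ ≡ 0

open Test

infix  4 _≡ᵗ_ _<ᵗ_
infixr 3 _∧ᵗ_
infixr 2 _∨ᵗ_ _⇒ᵗ_

_≡ᵗ_ _<ᵗ_ : ∀ {n} → Fn n → Fn n → Test n
F ≡ᵗ G = record
  { holds    = λ ρ → fun F ρ ≡ fun G ρ
  ; test     = (F ∸ᶠ G) +ᶠ (G ∸ᶠ F)
  ; sound    = λ ρ p → ≤-antisym
      (m∸n≡0⇒m≤n (m+n≡0⇒m≡0 _ p)) (m∸n≡0⇒m≤n (m+n≡0⇒n≡0 (fun F ρ ∸ fun G ρ) p))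
  ; complete = λ ρ p → cong₂ _+_ (m≤n⇒m∸n≡0 (≤-reflexive p)) (m≤n⇒m∸n≡0 (≤-reflexive (sym p)))
  }
F <ᵗ G = record
  { holds    = λ ρ → fun F ρ < fun G ρ
  ; test     = sucᶠ F ∸ᶠ G
  ; sound    = λ ρ → m∸n≡0⇒m≤n
  ; complete = λ ρ → m≤n⇒m∸n≡0
  }

_∧ᵗ_ _∨ᵗ_ _⇒ᵗ_ : ∀ {n} → Test n → Test n → Test n
P ∧ᵗ Q = record
  { holds    = λ ρ → holds P ρ × holds Q ρ
  ; test     = test P +ᶠ test Q
  ; sound    = λ ρ p → sound P ρ (m+n≡0⇒m≡0 _ p) , sound Q ρ (m+n≡0⇒n≡0 (fun (test P) ρ) p)
  ; complete = λ { ρ (p , q) → cong₂ _+_ (complete P ρ p) (complete Q ρ q) }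
  }
P ∨ᵗ Q = record
  { holds    = λ ρ → holds P ρ ⊎ holds Q ρ
  ; test     = test P *ᶠ test Q
  ; sound    = λ ρ p → [ inj₁ ∘ sound P ρ , inj₂ ∘ sound Q ρ ]′ (m*n≡0⇒m≡0∨n≡0 (fun (test P) ρ) p)
  ; complete = λ
      { ρ (inj₁ p) → cong (_* fun (test Q) ρ) (complete P ρ p)
      ; ρ (inj₂ q) → trans (cong (fun (test P) ρ *_) (complete Q ρ q)) (*-zeroʳ (fun (test P) ρ)) }
  }
P ⇒ᵗ Q = record
  { holds    = λ ρ → holds P ρ → holds Q ρ
  ; test     = (lit 1 ∸ᶠ test P) *ᶠ test Q
  ; sound    = λ ρ r p → sound Q ρ
      (trans (sym (*-identityˡ _)) (subst (λ z → (1 ∸ z) * fun (test Q) ρ ≡ 0) (complete P ρ p) r))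
  ; complete = complete′
  }
  where
  complete′ : ∀ ρ → (holds P ρ → holds Q ρ) → (1 ∸ fun (test P) ρ) * fun (test Q) ρ ≡ 0
  complete′ ρ r with fun (test P) ρ in eq
  ... | zero  = trans (*-identityˡ _) (complete Q ρ (r (sound P ρ eq)))
  ... | suc z = cong (_* fun (test Q) ρ) (0∸n≡0 z)

∀ᵗ ∃ᵗ : ∀ {n} → Fn n → Test (suc n) → Test n
∀ᵗ c P = record
  { holds    = λ ρ → ∀ i → i < fun c ρ → holds P (i ∷ ρ)
  ; test     = recᶠ c (lit 0) (var v0 +ᶠ wk (test P))
  ; sound    = λ ρ p i i<c → sound P _ (vanish (λ i → fun (test P) (i ∷ ρ)) (fun c ρ) p i i<c)
  ; complete = λ ρ p → vanish⁻¹ (λ i → fun (test P) (i ∷ ρ)) (fun c ρ) (λ i i<c → complete P _ (p i i<c))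
  }
  where
  vanish : ∀ f m → iter 0 (λ i a → a + f i) m ≡ 0 → ∀ i → i < m → f i ≡ 0
  vanish f (suc m) p i i<m with m<1+n⇒m<n∨m≡n i<m
  ... | inj₁ i<m′ = vanish f m (m+n≡0⇒m≡0 _ p) i i<m′
  ... | inj₂ refl = m+n≡0⇒n≡0 (iter 0 (λ i a → a + f i) m) p

  vanish⁻¹ : ∀ f m → (∀ i → i < m → f i ≡ 0) → iter 0 (λ i a → a + f i) m ≡ 0
  vanish⁻¹ f zero    p = refl
  vanish⁻¹ f (suc m) p = cong₂ _+_ (vanish⁻¹ f m (λ i i<m → p i (m<n⇒m<1+n i<m))) (p m ≤-refl)
∃ᵗ c P = record
  { holds    = λ ρ → ∃[ i ] (i < fun c ρ × holds P (i ∷ ρ))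
  ; test     = recᶠ c (lit 1) (var v0 *ᶠ wk (test P))
  ; sound    = λ ρ p → case vanish (λ i → fun (test P) (i ∷ ρ)) (fun c ρ) p of λ
      { (i , i<c , q) → i , i<c , sound P _ q }
  ; complete = λ { ρ (i , i<c , q) →
      vanish⁻¹ (λ i → fun (test P) (i ∷ ρ)) (fun c ρ) i i<c (complete P _ q) }
  }
  where
  vanish : ∀ f m → iter 1 (λ i a → a * f i) m ≡ 0 → ∃[ i ] (i < m × f i ≡ 0)
  vanish f (suc m) p with m*n≡0⇒m≡0∨n≡0 (iter 1 (λ i a → a * f i) m) p
  ... | inj₁ q = case vanish f m q of λ { (i , i<m , r) → i , m<n⇒m<1+n i<m , r }
  ... | inj₂ q = m , ≤-refl , q

  vanish⁻¹ : ∀ f m i → i < m → f i ≡ 0 → iter 1 (λ i a → a * f i) m ≡ 0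
  vanish⁻¹ f (suc m) i i<m p with m<1+n⇒m<n∨m≡n i<m
  ... | inj₁ i<m′ = cong (_* f m) (vanish⁻¹ f m i i<m′ p)
  ... | inj₂ refl = trans (cong (iter 1 (λ i a → a * f i) m *_) p) (*-zeroʳ (iter 1 (λ i a → a * f i) m))

least : ∀ (f : ℕ → ℕ) m → f m ≡ 0 → ∃[ l ] (f l ≡ 0 × (∀ i → i < l → ∃[ y ] f i ≡ suc y))
least f zero    p = 0 , p , λ _ ()
least f (suc m) p with f 0 in eq
... | zero  = 0 , eq , λ _ ()
... | suc y = case least (f ∘ suc) m p of λ { (l , q , r) →
  suc l , q , λ { zero _ → y , eq ; (suc i) i<l → r i (s<s⁻¹ i<l) } }

-- The test is total, so all values below its least zero are defined and are successors, as `min⇓`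
-- demands. Any witness suffices for termination, but the value found is the least one.
search : ∀ {n} (P : Test (suc n)) ρ → ∃[ m ] holds P (m ∷ ρ) →
         ∃[ l ] (holds P (l ∷ ρ) × minᵖ (prog (test P)) ⟨ env ρ ⟩⇓ l)
search P ρ (m , p) = case least (λ i → fun (test P) (i ∷ ρ)) m (complete P _ p) of λ { (l , q , r) →
  l , sound P _ q ,
  min⇓ (subst (prog (test P) ⟨ _ ⟩⇓_) q (computes (test P) _))
    λ i i<l → case r i i<l of λ { (y , eq) → y , subst (prog (test P) ⟨ _ ⟩⇓_) eq (computes (test P) _) } }

-- Codes of lists

cons : ℕ → ℕ → ℕ
cons x c = suc (pair x c)

nth : ℕ → ℕ → ℕ
nth c zero    = π₁ (pred c)
nth c (suc i) = nth (π₂ (pred c)) i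

-- Primitive recursion applies the last tail outermost, whereas `nth` takes tails from the inside;
-- `drop-tl` exchanges the two orders.
nthᶠ : ∀ {n} → Fn n → Fn n → Fn n
nthᶠ F G = π₁ᶠ (predF (recᶠ G F (π₂ᶠ (predF (var v0))))) ≗ᶠ (λ ρ → nth (fun F ρ) (fun G ρ))
  by λ ρ → trans (cong (π₁ ∘ pred) (shift _ (fun G ρ))) (lemma _ (fun G ρ))
  where
  predF : ∀ {n} → Fn n → Fn n
  predF F = call predᶠ (F ∷ [])

  tl : ℕ → ℕ
  tl c = π₂ (pred c)

  drop : ℕ → ℕ → ℕ
  drop c zero    = c
  drop c (suc i) = drop (tl c) i

  drop-tl : ∀ c i → drop (tl c) i ≡ tl (drop c i)
  drop-tl c zero    = refl
  drop-tl c (suc i) = drop-tl (tl c) i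

  shift : ∀ c i → iter c (λ _ → tl) i ≡ drop c i
  shift c zero    = refl
  shift c (suc i) = trans (cong tl (shift c i)) (sym (drop-tl c i))

  lemma : ∀ c i → π₁ (pred (drop c i)) ≡ nth c i
  lemma c zero    = refl
  lemma c (suc i) = lemma (tl c) i

nth-applyUpTo : ∀ (f : ℕ → ℕ) n {i} → i < n → nth (encList (applyUpTo f n)) i ≡ f i
nth-applyUpTo f (suc n) {zero}  _         = π₁-pair (f 0) _
nth-applyUpTo f (suc n) {suc i} (s≤s i<n) =
  trans (cong (λ c → nth c i) (π₂-pair (f 0) _)) (nth-applyUpTo (f ∘ suc) n i<n)

nth-tabulate : ∀ {n} (f : Fin n → ℕ) i → nth (encList (Vec.toList (tabulate f))) (toℕ i) ≡ f i
nth-tabulate f zero    = π₁-pair (f zero) _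
nth-tabulate f (suc i) =
  trans (cong (λ c → nth c (toℕ i)) (π₂-pair (f zero) _)) (nth-tabulate (f ∘ suc) i)

-- tab n f z is the code of f 0 ∷ … ∷ f (n-1) ∷ zs, for z the code of zs.
tab : ℕ → (ℕ → ℕ) → ℕ → ℕ
tab zero    f z = z
tab (suc n) f z = cons (f 0) (tab n (f ∘ suc) z)

tabᶠ : ∀ {n} → Fn n → Fn (suc n) → Fn n → Fn n
tabᶠ {n} c F z = recᶠ c z (sucᶠ (pairᶠ entry (var v0)))
  ≗ᶠ (λ ρ → tab (fun c ρ) (λ i → fun F (i ∷ ρ)) (fun z ρ))
  by λ ρ → lemma (λ i → fun F (i ∷ ρ)) (fun c ρ)
  where
  -- The list grows from its end, so round i of the recursion supplies the entry with index c ∸ suc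
  -- i.
  index : Fn (2 + n)
  index = wk (wk c) ∸ᶠ sucᶠ (var v1)

  entry : Fn (2 + n)
  entry = record
    { fun      = λ ρ → fun F (fun index ρ ∷ Vec.tail (Vec.tail ρ))
    ; prog     = compᵖ (prog F) (pairᵖ (compᵖ fstᵖ fstᵖ) (prog index))
    ; computes = λ { (a ∷ i ∷ ρ) → comp⇓
        (pair⇓ (comp⇓ (fst⇓ {x = pair (env ρ) i} {y = a}) (fst⇓ {x = env ρ} {y = i}))
               (computes index (a ∷ i ∷ ρ)))
        (computes F (fun index (a ∷ i ∷ ρ) ∷ ρ)) }
    }

  iter-cong : ∀ {z} {f g : ℕ → ℕ} m → (∀ i → i < m → f i ≡ g i) →
              iter z (λ i a → cons (f i) a) m ≡ iter z (λ i a → cons (g i) a) m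
  iter-cong zero    p = refl
  iter-cong (suc m) p =
    cong₂ cons (p m ≤-refl) (iter-cong m λ i i<m → p i (m<n⇒m<1+n i<m))

  lemma : ∀ {z} (f : ℕ → ℕ) m → iter z (λ i a → cons (f (m ∸ suc i)) a) m ≡ tab m f z
  lemma f zero    = refl
  lemma f (suc m) = cong₂ cons (cong f (n∸n≡0 m)) (trans
    (iter-cong {f = λ i → f (suc m ∸ suc i)} {g = λ i → f (suc (m ∸ suc i))} m
      λ i i<m → cong f (+-∸-assoc 1 i<m))
    (lemma (f ∘ suc) m))

encList-toList-tabulate : ∀ {n} (f : ℕ → ℕ) (g : Fin n → ℕ) → (∀ i → g i ≡ f (toℕ i)) →
                          encList (Vec.toList (tabulate g)) ≡ tab n f 0
encList-toList-tabulate {zero}  f g p = refl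
encList-toList-tabulate {suc n} f g p =
  cong₂ cons (p zero) (encList-toList-tabulate (f ∘ suc) (g ∘ suc) (p ∘ suc))

encList-tabulate-++ : ∀ {n} (f : ℕ → ℕ) (g : Fin n → ℕ) → (∀ i → g i ≡ f (toℕ i)) → ∀ xs →
                      encList (List.tabulate g ++ xs) ≡ tab n f (encList xs)
encList-tabulate-++ {zero}  f g p xs = refl
encList-tabulate-++ {suc n} f g p xs =
  cong₂ cons (p zero) (encList-tabulate-++ (f ∘ suc) (g ∘ suc) (p ∘ suc) xs)

encList-injective : ∀ {xs ys} → encList xs ≡ encList ys → xs ≡ ys
encList-injective {[]}     {[]}     p = refl
encList-injective {x ∷ xs} {y ∷ ys} p = case pair-injective {x} {_} {y} (suc-injective p) of λ
  { (q , r) → cong₂ _∷_ q (encList-injective r) }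

-- Codes of graphs and of their expansions

bit : Bool → ℕ
bit b = if b then 1 else 0

bit-injective : ∀ {b c} → bit b ≡ bit c → b ≡ c
bit-injective {false} {false} p = refl
bit-injective {true}  {true}  p = refl

adjTable : Graph → ℕ
adjTable G = encList (Vec.toList (tabulate λ a → encList (Vec.toList (tabulate λ b → bit (adj G a b)))))

nth-adjTable : ∀ G x y → nth (nth (adjTable G) (toℕ x)) (toℕ y) ≡ bit (adj G x y)
nth-adjTable G x y = trans (cong (λ c → nth c (toℕ y)) (nth-tabulate _ x)) (nth-tabulate _ y)

Star[_] : ℕ → Vocabulary
Star[ n ] = starVocabulary (E ∷ []) n

_⋆ : (G : Graph) → Structure Star[ order G ]
G ⋆ = star (proj₂ (graphStructure G))

starVocabularyCode : ℕ → ℕ → ℕ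
starVocabularyCode n z = cons (encSymbol E) (tab n (λ i → pair (suc i) 1) z)

starCode : ℕ → ℕ → ℕ
starCode n adjs =
  pair (starVocabularyCode n 0)
    (pair n (cons adjs (tab n (λ h → tab n (λ a → 1 ∸ ((h ∸ a) + (a ∸ h))) 0) 0)))

encList-map-Star : ∀ (f : Symbol → ℕ) n xs →
  encList (map f Star[ n ] ++ xs) ≡ cons (f E) (tab n (λ i → f (suc i , 1)) (encList xs))
encList-map-Star f n xs = cong (cons (f E)) (trans
  (cong (λ ys → encList (ys ++ xs))
    (trans (sym (List.map-∘ {g = f} {f = c} (allFin n))) (List.map-tabulate id (f ∘ c))))
  (encList-tabulate-++ (λ i → f (suc i , 1)) (f ∘ c) (λ _ → refl) xs))
  where
  c : Fin n → Symbol
  c a = C (E ∷ []) (toℕ a)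

bit-≡ᵇ : ∀ m n → bit (m ≡ᵇ n) ≡ 1 ∸ ((m ∸ n) + (n ∸ m))
bit-≡ᵇ zero    zero    = refl
bit-≡ᵇ zero    (suc n) = sym (0∸n≡0 n)
bit-≡ᵇ (suc m) zero    = sym (0∸n≡0 (m + 0))
bit-≡ᵇ (suc m) (suc n) = bit-≡ᵇ m n

tab-cong : ∀ n {f g : ℕ → ℕ} {z} → (∀ i → f i ≡ g i) → tab n f z ≡ tab n g z
tab-cong zero    p = refl
tab-cong (suc n) p = cong₂ cons (p 0) (tab-cong n (p ∘ suc))

encVocabulary-Star : ∀ n → encVocabulary Star[ n ] ≡ starVocabularyCode n 0
encVocabulary-Star n = trans
  (cong encList (sym (List.++-identityʳ (map encSymbol Star[ n ]))))
  (encList-map-Star encSymbol n [])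

encList-cong : ∀ {n} {f g : Fin n → ℕ} → (∀ i → f i ≡ g i) →
               encList (Vec.toList (tabulate f)) ≡ encList (Vec.toList (tabulate g))
encList-cong p = cong (encList ∘ Vec.toList) (Vec.tabulate-cong p)

-- Since `fresh (E ∷ [])` is 1, C_a has the name suc a. Proofs about `Star[ n ]` split on this
-- result while the membership proof itself stays abstract.
∈-Star : ∀ {n R} → R ∈ Star[ n ] → R ≡ E ⊎ ∃[ a ] (a < n × R ≡ (suc a , 1))
∈-Star (here refl) = inj₁ refl
∈-Star (there R∈)  = case ∈-map⁻ _ R∈ of λ { (a , _ , refl) → inj₂ (toℕ a , Fin.toℕ<n a , refl) }

E∈Star : ∀ {n} → E ∈ Star[ n ]
E∈Star = here refl

C∈Star : ∀ {n a} → a < n → (suc a , 1) ∈ Star[ n ]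
C∈Star {n} a<n = there (subst (λ a → (suc a , 1) ∈ _) (Fin.toℕ-fromℕ< a<n)
  (∈-map⁺ (λ a → C (E ∷ []) (toℕ a)) (∈-allFin (fromℕ< a<n))))

-- Here 1 ∸ ((h ∸ a) + (a ∸ h)) is the truth value of h ≡ a, in the form it takes as a Fn.
code-star : ∀ G → ⌜ Star[ order G ] , G ⋆ ⌝ ≡ starCode (order G) (adjTable G)
code-star G = cong₂ pair (encVocabulary-Star n) (cong (pair n) (begin
  encList (mapWith∈ Star[ n ] λ {R} R∈τ → encRelation (arity R) (rel (G ⋆) R R∈τ))
    ≡⟨ cong encList (mapWith∈-cong Star[ n ] _ (λ {R} _ → table R) (λ R∈τ → table≡ _ R∈τ (∈-Star R∈τ))) ⟩
  encList (mapWith∈ Star[ n ] λ {R} _ → table R)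
    ≡⟨ cong encList (mapWith∈≗map table Star[ n ]) ⟩
  encList (map table Star[ n ])
    ≡⟨ cong encList (sym (List.++-identityʳ (map table Star[ n ]))) ⟩
  encList (map table Star[ n ] ++ [])
    ≡⟨ encList-map-Star table n [] ⟩
  cons (adjTable G) (tab n (λ h → tab n (λ a → 1 ∸ ((h ∸ a) + (a ∸ h))) 0) 0) ∎))
  where
  open ≡-Reasoning
  n = order G

  table : Symbol → ℕ
  table (suc h , _) = tab n (λ a → 1 ∸ ((h ∸ a) + (a ∸ h))) 0
  table (zero  , _) = adjTable G

  table≡ : ∀ R (R∈τ : R ∈ Star[ n ]) → R ≡ E ⊎ ∃[ a ] (a < n × R ≡ (suc a , 1)) →
           encRelation (arity R) (rel (G ⋆) R R∈τ) ≡ table R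
  table≡ _ _ (inj₁ refl) =
    encList-cong λ a → encList-cong λ b → cong bit (Bool.∨-identityʳ (adj G a b))
  table≡ _ _ (inj₂ (h , _ , refl)) = encList-toList-tabulate _ _ λ a → bit-≡ᵇ h (toℕ a)

-- Semantics of quantifier-free formulas

module _ {σ r w} (A : Structure σ) (as : Vec (Vec (Fin (size A)) w) r) where

  val : Fin r × Fin w → Fin (size A)
  val (i , j) = lookup (lookup as i) j

  Sat : Formula σ r w → Set
  Sat (atom R R∈σ xs) = T (rel A R R∈σ (Vec.map val xs))
  Sat (x ≐ y)         = val x ≡ val y
  Sat (¬′ φ)          = ¬ Sat φ
  Sat (φ ∧′ ψ)        = Sat φ × Sat ψ
  Sat (φ ∨′ ψ)        = Sat φ ⊎ Sat ψ

  private
    truth : Formula σ r w → Bool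
    truth (atom R R∈σ xs) = rel A R R∈σ (Vec.map val xs)
    truth (x ≐ y)         = does (val x Fin.≟ val y)
    truth (¬′ φ)          = not (truth φ)
    truth (φ ∧′ ψ)        = truth φ ∧ truth ψ
    truth (φ ∨′ ψ)        = truth φ ∨ truth ψ

    sat? : ∀ φ → Dec (Sat φ)
    sat? (atom R R∈σ xs) = T? _
    sat? (x ≐ y)         = val x Fin.≟ val y
    sat? (¬′ φ)          = ¬? (sat? φ)
    sat? (φ ∧′ ψ)        = sat? φ ×-dec sat? ψ
    sat? (φ ∨′ ψ)        = sat? φ ⊎-dec sat? ψ

    does-sat? : ∀ φ → does (sat? φ) ≡ truth φ
    does-sat? (atom R R∈σ xs) = refl
    does-sat? (x ≐ y)         = refl
    does-sat? (¬′ φ)          = cong not (does-sat? φ)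
    does-sat? (φ ∧′ ψ)        = cong₂ _∧_ (does-sat? φ) (does-sat? ψ)
    does-sat? (φ ∨′ ψ)        = cong₂ _∨_ (does-sat? φ) (does-sat? ψ)

    -- The left side is the local evaluator of ⟦ χ ⟧, which depends on χ and has no name
    -- outside Defs: it is found by unification with the use in ⟦⟧-¬.
    eval≡truth : (χ φ : Formula σ r w) → _ ≡ truth φ

    ⟦⟧-¬ : ∀ φ → ⟦ ¬′ φ ⟧ A as ≡ not (truth φ)
    ⟦⟧-¬ φ with ¬′ φ
    ... | χ = cong not (eval≡truth χ φ)

    eval≡truth χ (atom R R∈σ xs) = cong (rel A R R∈σ) (Vec.map-cong (λ { (i , j) → refl }) xs)
    eval≡truth χ (x ≐ y)         = refl
    eval≡truth χ (¬′ φ)          = cong not (eval≡truth χ φ)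
    eval≡truth χ (φ ∧′ ψ)        = cong₂ _∧_ (eval≡truth χ φ) (eval≡truth χ ψ)
    eval≡truth χ (φ ∨′ ψ)        = cong₂ _∨_ (eval≡truth χ φ) (eval≡truth χ ψ)

  sat : ∀ φ → T (⟦ φ ⟧ A as) ⇔ Sat φ
  sat φ = subst (λ b → T b ⇔ Sat φ) (trans (does-sat? φ) (sym (eval≡truth φ φ))) (dec⇔ (sat? φ))
    where
    dec⇔ : ∀ {P : Set} (P? : Dec P) → T (does P?) ⇔ P
    dec⇔ (yes p) = mk⇔ (λ _ → p) (λ _ → tt)
    dec⇔ (no ¬p) = mk⇔ (λ ()) ¬p

conj : ∀ {I : Set} {σ r w} → (I → Formula σ r w) → List I → Formula σ r w → Formula σ r w
conj f []       φ = φ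
conj f (i ∷ is) φ = f i ∧′ conj f is φ

sat-conj⁺ : ∀ {I : Set} {σ r w} (A : Structure σ) (as : Vec (Vec (Fin (size A)) w) r)
            {f : I → Formula σ r w} is {φ} → (∀ i → Sat A as (f i)) → Sat A as φ → Sat A as (conj f is φ)
sat-conj⁺ A as []       p q = q
sat-conj⁺ A as (i ∷ is) p q = p i , sat-conj⁺ A as is p q

sat-conj⁻ : ∀ {I : Set} {σ r w} (A : Structure σ) (as : Vec (Vec (Fin (size A)) w) r)
            {f : I → Formula σ r w} {is φ} → Sat A as (conj f is φ) →
            (∀ {i} → i ∈ is → Sat A as (f i)) × Sat A as φ
sat-conj⁻ A as {is = []}     p       = (λ ()) , p
sat-conj⁻ A as {is = i ∷ is} (p , q) = case sat-conj⁻ A as {is = is} q of λ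
  { (r , s) → (λ { (here refl) → p ; (there i∈is) → r i∈is }) , s }

-- Atoms over a structure ⟨ A , B ⟩

⟦⟧-∈ : ∀ {τ} (A : Structure τ) R (R∈τ : R ∈ τ) v → _⟦_⟧ A R v ≡ rel A R R∈τ v
⟦⟧-∈ {τ} A R R∈τ v with R ∈? τ
... | yes _   = refl
... | no R∉τ = contradiction R∈τ R∉τ

⟦⟧-∉ : ∀ {τ} (A : Structure τ) R → ¬ (R ∈ τ) → ∀ v → _⟦_⟧ A R v ≡ false
⟦⟧-∉ {τ} A R R∉τ v with R ∈? τ
... | yes R∈τ = contradiction R∈τ R∉τ
... | no _    = refl

name<fresh : ∀ {τ R} → R ∈ τ → name R < fresh τ
name<fresh {S ∷ τ} (here refl) = m≤m⊔n (suc (name S)) (fresh τ)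
name<fresh {S ∷ τ} (there R∈τ) = ≤-trans (name<fresh R∈τ) (m≤n⊔m (suc (name S)) (fresh τ))

<⇒≡ᵇ-false : ∀ {m n} → m < n → (m ≡ᵇ n) ≡ false
<⇒≡ᵇ-false {zero}  {suc n} _         = refl
<⇒≡ᵇ-false {suc m} {suc n} (s≤s m<n) = <⇒≡ᵇ-false m<n

1+n≢ᵇn : ∀ n → (suc n ≡ᵇ n) ≡ false
1+n≢ᵇn zero    = refl
1+n≢ᵇn (suc n) = 1+n≢ᵇn n

≡ᵇ-refl : ∀ n → (n ≡ᵇ n) ≡ true
≡ᵇ-refl zero    = refl
≡ᵇ-refl (suc n) = ≡ᵇ-refl n

module _ {τ} (A B : Structure τ) where

  inˡ : Fin (size A) → Fin (size A + size B)
  inˡ a = a ↑ˡ size B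

  inʳ : Fin (size B) → Fin (size A + size B)
  inʳ b = size A ↑ʳ b

  inˡ⊎inʳ : ∀ x → (∃[ a ] x ≡ inˡ a) ⊎ (∃[ b ] x ≡ inʳ b)
  inˡ⊎inʳ x with splitAt (size A) x | Fin.join-splitAt (size A) (size B) x
  ... | inj₁ a | eq = inj₁ (a , sym eq)
  ... | inj₂ b | eq = inj₂ (b , sym eq)

  -- Names in τ lie below `fresh (τ ++ τ)`, so the marks P₁ and P₂ contribute nothing to these
  -- atoms.
  unary-inˡ : ∀ c (c∈τ : (c , 1) ∈ τ) .(c∈ : (c , 1) ∈ pairVocabulary τ τ) a →
              rel ⟨ A , B ⟩ (c , 1) c∈ (inˡ a ∷ []) ≡ rel A (c , 1) c∈τ (a ∷ [])
  unary-inˡ c c∈τ _ a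
    rewrite Fin.splitAt-↑ˡ (size A) a (size B)
          | ⟦⟧-∈ A (c , 1) c∈τ (a ∷ [])
          | <⇒≡ᵇ-false (name<fresh (∈-++⁺ˡ {ys = τ} c∈τ))
          | <⇒≡ᵇ-false (m<n⇒m<1+n (name<fresh (∈-++⁺ˡ {ys = τ} c∈τ)))
    = Bool.∨-identityʳ _

  unary-inʳ : ∀ c (c∈τ : (c , 1) ∈ τ) .(c∈ : (c , 1) ∈ pairVocabulary τ τ) b →
              rel ⟨ A , B ⟩ (c , 1) c∈ (inʳ b ∷ []) ≡ rel B (c , 1) c∈τ (b ∷ [])
  unary-inʳ c c∈τ _ b
    rewrite Fin.splitAt-↑ʳ (size A) (size B) b
          | ⟦⟧-∈ B (c , 1) c∈τ (b ∷ [])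
          | <⇒≡ᵇ-false (name<fresh (∈-++⁺ˡ {ys = τ} c∈τ))
          | <⇒≡ᵇ-false (m<n⇒m<1+n (name<fresh (∈-++⁺ˡ {ys = τ} c∈τ)))
    = Bool.∨-identityʳ _

  binary-inˡ : ∀ c (c∈τ : (c , 2) ∈ τ) .(c∈ : (c , 2) ∈ pairVocabulary τ τ) a a′ →
               rel ⟨ A , B ⟩ (c , 2) c∈ (inˡ a ∷ inˡ a′ ∷ []) ≡ rel A (c , 2) c∈τ (a ∷ a′ ∷ [])
  binary-inˡ c c∈τ _ a a′
    rewrite Fin.splitAt-↑ˡ (size A) a (size B)
          | Fin.splitAt-↑ˡ (size A) a′ (size B)
          | ⟦⟧-∈ A (c , 2) c∈τ (a ∷ a′ ∷ [])
    = Bool.∨-identityʳ _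

  binary-inʳ : ∀ c (c∈τ : (c , 2) ∈ τ) .(c∈ : (c , 2) ∈ pairVocabulary τ τ) b b′ →
               rel ⟨ A , B ⟩ (c , 2) c∈ (inʳ b ∷ inʳ b′ ∷ []) ≡ rel B (c , 2) c∈τ (b ∷ b′ ∷ [])
  binary-inʳ c c∈τ _ b b′
    rewrite Fin.splitAt-↑ʳ (size A) (size B) b
          | Fin.splitAt-↑ʳ (size A) (size B) b′
          | ⟦⟧-∈ B (c , 2) c∈τ (b ∷ b′ ∷ [])
    = Bool.∨-identityʳ _

  private
    P₁∉τ : ¬ (P₁ (τ ++ τ) ∈ τ)
    P₁∉τ p = <-irrefl refl (name<fresh (∈-++⁺ˡ {ys = τ} p))

    P₂∉τ : ¬ (P₂ (τ ++ τ) ∈ τ)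
    P₂∉τ p = <-asym (n<1+n _) (name<fresh (∈-++⁺ˡ {ys = τ} p))

  P₁-inˡ : ∀ .p a → T (rel ⟨ A , B ⟩ (P₁ (τ ++ τ)) p (inˡ a ∷ []))
  P₁-inˡ _ a
    rewrite Fin.splitAt-↑ˡ (size A) a (size B)
          | ⟦⟧-∉ A (P₁ (τ ++ τ)) P₁∉τ (a ∷ []) | ≡ᵇ-refl (fresh (τ ++ τ)) = tt

  P₁-inʳ : ∀ .p b → ¬ T (rel ⟨ A , B ⟩ (P₁ (τ ++ τ)) p (inʳ b ∷ []))
  P₁-inʳ _ b
    rewrite Fin.splitAt-↑ʳ (size A) (size B) b
          | ⟦⟧-∉ B (P₁ (τ ++ τ)) P₁∉τ (b ∷ [])
          | ≡ᵇ-refl (fresh (τ ++ τ)) | <⇒≡ᵇ-false (n<1+n (fresh (τ ++ τ))) = id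

  P₂-inʳ : ∀ .p b → T (rel ⟨ A , B ⟩ (P₂ (τ ++ τ)) p (inʳ b ∷ []))
  P₂-inʳ _ b
    rewrite Fin.splitAt-↑ʳ (size A) (size B) b
          | ⟦⟧-∉ B (P₂ (τ ++ τ)) P₂∉τ (b ∷ [])
          | ≡ᵇ-refl (fresh (τ ++ τ)) | Bool.∧-zeroʳ (suc (fresh (τ ++ τ)) ≡ᵇ fresh (τ ++ τ)) = tt

  P₂-inˡ : ∀ .p a → ¬ T (rel ⟨ A , B ⟩ (P₂ (τ ++ τ)) p (inˡ a ∷ []))
  P₂-inˡ _ a
    rewrite Fin.splitAt-↑ˡ (size A) a (size B)
          | ⟦⟧-∉ A (P₂ (τ ++ τ)) P₂∉τ (a ∷ [])
          | ≡ᵇ-refl (fresh (τ ++ τ)) | 1+n≢ᵇn (fresh (τ ++ τ)) = id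

-- The interpretation

-- The slots (h , i) with i < k and t h i < |G| list the elements t h i of the bag of h; a value
-- t h i ≥ |G| marks the slot as unused.
record Slots (H G : Graph) (k : ℕ) (t : ℕ → ℕ → ℕ) : Set where
  Slot : Set
  Slot = Fin (order H) × Fin k

  entry : Slot → ℕ
  entry (h , i) = t (toℕ h) (toℕ i)

  -- A link may stay at one vertex of H: the same g can occupy several slots of one bag, and these
  -- have to be joined too.
  Link : Fin (order G) → Slot → Slot → Set
  Link g s s′ = ReflE H (proj₁ s) (proj₁ s′) × entry s ≡ toℕ g × entry s′ ≡ toℕ g

  field
    cover   : ∀ {g g′} → ReflE G g g′ →
              ∃[ s ] ∃[ s′ ] (ReflE H (proj₁ s) (proj₁ s′) × entry s ≡ toℕ g × entry s′ ≡ toℕ g′)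
    connect : ∀ g {s s′} → entry s ≡ toℕ g → entry s′ ≡ toℕ g → Star (Link g) s s′

-- A (k + k)-tuple (u₁,…,u_k,x₁,…,x_k) stands for the partial map u_i ↦ x_i from G to B, where
-- u_i lies in the first and x_i in the second part of ⟨ G⋆ , B ⟩.
module _ {k : ℕ} where

  argument value : Fin k → Fin (k + k)
  argument i = i ↑ˡ k
  value    i = k ↑ʳ i

¬nullary∈Star : ∀ {m c} → ¬ ((c , 0) ∈ Star[ m ])
¬nullary∈Star p with ∈-Star p
... | inj₁ ()
... | inj₂ (_ , _ , ())

module Formulas (n : ℕ) {k : ℕ} (z : Fin k) where

  Σ² : Vocabulary
  Σ² = pairVocabulary Star[ n ] Star[ n ]

  ∈-Σ² : ∀ {R} → R ∈ Star[ n ] → R ∈ Σ²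
  ∈-Σ² R∈ = ∈-++⁺ˡ {ys = P₁ (Star[ n ] ++ Star[ n ]) ∷ P₂ (Star[ n ] ++ Star[ n ]) ∷ []}
    (∈-++⁺ˡ {ys = Star[ n ]} R∈)

  P₁∈ : P₁ (Star[ n ] ++ Star[ n ]) ∈ Σ²
  P₁∈ = ∈-++⁺ʳ (Star[ n ] ++ Star[ n ]) (here refl)

  P₂∈ : P₂ (Star[ n ] ++ Star[ n ]) ∈ Σ²
  P₂∈ = ∈-++⁺ʳ (Star[ n ] ++ Star[ n ]) (there (here refl))

  module _ {r w : ℕ} where

    edge : Fin r × Fin w → Fin r × Fin w → Formula Σ² r w
    edge p q = atom E (∈-Σ² (E∈Star {n})) (p ∷ q ∷ [])

    unary : ∀ c → .((c , 1) ∈ Σ²) → Fin r × Fin w → Formula Σ² r w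
    unary c c∈ p = atom (c , 1) c∈ (p ∷ [])

  -- Formulas have no constant for truth, so an equation between equal variables replaces it; `z`
  -- supplies the variable and exists because 1 ≤ k.
  trivial : ∀ {r} → Formula Σ² (suc r) (k + k)
  trivial = (zero , argument z) ≐ (zero , argument z)

  -- For a = b the conjuncts make one tuple a well-defined partial homomorphism. For two tuples only
  -- the cross conditions are stated, with edges directed from a to b; the conditions inside each
  -- tuple come from the bag formulas.
  compatibleAt : ∀ {r} → Fin r → Fin r → Fin k × Fin k → Formula Σ² r (k + k)
  compatibleAt a b (i , j) =
    ((¬′ ((a , argument i) ≐ (b , argument j))) ∨′ ((a , value i) ≐ (b , value j))) ∧′
    ((¬′ edge (a , argument i) (b , argument j)) ∨′ edge (a , value i) (b , value j))

  pairs : List (Fin k × Fin k)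
  pairs = cartesianProduct (allFin k) (allFin k)

  compatible : ∀ {r} → Fin (suc r) → Fin (suc r) → Formula Σ² (suc r) (k + k)
  compatible a b = conj (compatibleAt a b) pairs trivial

  -- C_g is interpreted in both parts of the pair. Together with P₁ it pins the argument to the copy
  -- of g; together with P₂ it places the image in the set C_g of B.
  occupied : ∀ {g} → g < n → Fin k → Formula Σ² 1 (k + k)
  occupied {g} g<n i =
    (unary (fresh (Star[ n ] ++ Star[ n ])) P₁∈ (zero , argument i) ∧′
     unary (suc g) (∈-Σ² (C∈Star g<n)) (zero , argument i)) ∧′
    (unary (suc (fresh (Star[ n ] ++ Star[ n ]))) P₂∈ (zero , value i) ∧′
     unary (suc g) (∈-Σ² (C∈Star g<n)) (zero , value i))

  slot : ∀ {g} → Dec (g < n) → Fin k → Formula Σ² 1 (k + k)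
  slot (yes g<n) i = occupied g<n i
  slot (no _)    i = trivial

  module _ (t : ℕ → ℕ → ℕ) where

    bagFormula : ℕ → Formula Σ² 1 (k + k)
    bagFormula h = conj (λ i → slot (t h (toℕ i) <? n) i) (allFin k) (compatible zero zero)

    relationFormula : ∀ {m} (R : Symbol) → .(R ∈ Star[ m ]) → Formula Σ² (arity R) (k + k)
    relationFormula (zero  , 2)     _  = compatible zero (suc zero)
    relationFormula (suc h , 1)     _  = bagFormula h
    -- In arity 0 there are no variables, hence no `trivial`; the case is vacuous because
    -- `Star[ m ]` has no nullary symbol.
    relationFormula (c     , zero)  R∈ = ⊥-elim-irr (¬nullary∈Star R∈)
    relationFormula (c     , suc r) _  = trivial

    interpretation : ∀ m → Interpretation (k + k) Star[ m ] Σ²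
    interpretation m = record
      -- Every tuple is kept, even one that encodes no partial map, so the value is always defined
      -- and non-empty. Each vertex of `H ⋆` lies in some C_h, so homomorphisms reach only tuples
      -- satisfying a bag formula.
      { φU = trivial
      ; φ= = conj (λ j → (zero , j) ≐ (suc zero , j)) (allFin (k + k)) trivial
      ; φR = relationFormula {m}
      }

funToFin-cong : ∀ {a b} {f g : Fin a → Fin b} → (∀ i → f i ≡ g i) → Fin.funToFin f ≡ Fin.funToFin g
funToFin-cong {zero}  p = refl
funToFin-cong {suc a} p = cong₂ Fin.combine (p zero) (funToFin-cong (p ∘ suc))

-- The value of an interpretation that identifies no two tuples

module _ {n k : ℕ} (z : Fin k) (t : ℕ → ℕ → ℕ) (m : ℕ) (M : Structure (Formulas.Σ² n z)) where
  open Formulas n z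

  private
    N w : ℕ
    N = size M
    w = k + k

    I : Interpretation w Star[ m ] Σ²
    I = interpretation t m

  tuple : Fin (N ^ w) → Vec (Fin N) w
  tuple x = tabulate (Fin.finToFun x)

  untuple : Vec (Fin N) w → Fin (N ^ w)
  untuple v = Fin.funToFin (lookup v)

  tuple-untuple : ∀ v → tuple (untuple v) ≡ v
  tuple-untuple v = trans (Vec.tabulate-cong (Fin.finToFun-funToFin (lookup v))) (Vec.tabulate∘lookup v)

  untuple-tuple : ∀ x → untuple (tuple x) ≡ x
  untuple-tuple x = trans
    (funToFin-cong {w} {N} (Vec.lookup∘tabulate (Fin.finToFun x))) (Fin.funToFin-finToFin {w} {N} x)

  valueOf : Structure Star[ m ]
  valueOf = record
    { size     = N ^ w
    ; nonEmpty = m^n≢0 N w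
    ; rel      = λ R R∈ v → ⟦ φR I R R∈ ⟧ M (Vec.map tuple v)
    }

  interprets : Interprets I M valueOf
  interprets = record
    { f          = untuple ∘ proj₁
    ; surjective = λ x → (tuple x , Equivalence.from (sat M (tuple x ∷ []) (φU I)) refl) ,
                          λ { refl → untuple-tuple x }
    ; equality   = λ { (v , _) (v′ , _) → mk⇔
        (λ p → cong untuple (lookup-ext v v′ λ j →
          proj₁ (sat-conj⁻ M (v ∷ v′ ∷ []) (Equivalence.to (sat M (v ∷ v′ ∷ []) (φ= I)) p)) (∈-allFin j)))
        (λ p → Equivalence.from (sat M (v ∷ v′ ∷ []) (φ= I)) (sat-conj⁺ M (v ∷ v′ ∷ []) (allFin w)
          (λ j → cong (λ u → lookup u j) (untuple-injective v v′ p)) refl)) }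
    ; relations  = λ R R∈ as → subst (λ vs → T (⟦ φR I R R∈ ⟧ M (Vec.map proj₁ as)) ⇔ T (⟦ φR I R R∈ ⟧ M vs))
        (sym (tuples as)) (mk⇔ id id)
    }
    where
    lookup-ext : ∀ (v v′ : Vec (Fin N) w) → (∀ j → lookup v j ≡ lookup v′ j) → v ≡ v′
    lookup-ext v v′ p =
      trans (sym (Vec.tabulate∘lookup v)) (trans (Vec.tabulate-cong p) (Vec.tabulate∘lookup v′))

    untuple-injective : ∀ v v′ → untuple v ≡ untuple v′ → v ≡ v′
    untuple-injective v v′ p =
      trans (sym (tuple-untuple v)) (trans (cong tuple p) (tuple-untuple v′))

    tuples : ∀ {r} (as : Vec (Domain I M) r) →
             Vec.map tuple (Vec.map (untuple ∘ proj₁) as) ≡ Vec.map proj₁ as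
    tuples as = trans (sym (Vec.map-∘ tuple (untuple ∘ proj₁) as)) (Vec.map-cong (tuple-untuple ∘ proj₁) as)

-- Correctness of the reduction

T-resp : ∀ {b c} → b ≡ c → T b → T c
T-resp = subst T

module Reduction {G H : Graph} {k : ℕ} (z : Fin k) {t : ℕ → ℕ → ℕ} (S : Slots H G k t)
                 (B : Structure Star[ order G ]) where
  open Slots S
  open Formulas (order G) z

  private
    n w : ℕ
    n = order G
    w = k + k

    M : Structure Σ²
    M = ⟨ G ⋆ , B ⟩

  B′ : Structure Star[ order H ]
  B′ = valueOf z t (order H) M

  Tuple : Set
  Tuple = Vec (Fin (size M)) w

  arg img : Tuple → Fin k → Fin (size M)
  arg v i = lookup v (argument i)
  img v i = lookup v (value i)

  Edge : Fin (size M) → Fin (size M) → Set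
  Edge x y = T (rel M E (∈-Σ² (E∈Star {n})) (x ∷ y ∷ []))

  edgeˡ : ∀ a a′ → rel M E (∈-Σ² (E∈Star {n})) (inˡ (G ⋆) B a ∷ inˡ (G ⋆) B a′ ∷ []) ≡ adj G a a′
  edgeˡ a a′ = trans (binary-inˡ (G ⋆) B 0 (E∈Star {n}) (∈-Σ² (E∈Star {n})) a a′) (Bool.∨-identityʳ _)

  edgeʳ : ∀ b b′ → rel M E (∈-Σ² (E∈Star {n})) (inʳ (G ⋆) B b ∷ inʳ (G ⋆) B b′ ∷ []) ≡
                   rel B E (E∈Star {n}) (b ∷ b′ ∷ [])
  edgeʳ = binary-inʳ (G ⋆) B 0 (E∈Star {n}) (∈-Σ² (E∈Star {n}))

  Compatible : Tuple → Tuple → Set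
  Compatible v v′ = ∀ i j → (arg v i ≡ arg v′ j → img v i ≡ img v′ j) ×
                            (Edge (arg v i) (arg v′ j) → Edge (img v i) (img v′ j))

  module _ {r} (as : Vec Tuple (suc r)) (a b : Fin (suc r)) where

    compatible⁻ : Sat M as (compatible a b) → Compatible (lookup as a) (lookup as b)
    compatible⁻ p i j = case q of λ { (q₁ , q₂) → implies q₁ , implies q₂ }
      where
      implies : ∀ {P Q : Set} → ¬ P ⊎ Q → P → Q
      implies (inj₁ ¬p) p = contradiction p ¬p
      implies (inj₂ q)  _ = q

      q : Sat M as (compatibleAt a b (i , j))
      q = proj₁ (sat-conj⁻ M as {f = compatibleAt a b} {is = pairs} p)
                (∈-cartesianProduct⁺ (∈-allFin i) (∈-allFin j))

    compatible⁺ : Compatible (lookup as a) (lookup as b) → Sat M as (compatible a b)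
    compatible⁺ c = sat-conj⁺ M as {f = compatibleAt a b} pairs
      (λ { (i , j) → implies (_ Fin.≟ _) (proj₁ (c i j)) , implies (T? _) (proj₂ (c i j)) }) refl
      where
      implies : ∀ {P Q : Set} → Dec P → (P → Q) → ¬ P ⊎ Q
      implies (yes p) f = inj₂ (f p)
      implies (no ¬p) _ = inj₁ ¬p

  module _ {g} (g<n : g < n) (v : Tuple) (i : Fin k) where

    occupied⁻ : Sat M (v ∷ []) (occupied g<n i) →
                arg v i ≡ inˡ (G ⋆) B (fromℕ< g<n) ×
                ∃[ b ] (img v i ≡ inʳ (G ⋆) B b × T (rel B (suc g , 1) (C∈Star g<n) (b ∷ [])))
    occupied⁻ ((p₁ , p₂) , (q₁ , q₂)) = first (inˡ⊎inʳ (G ⋆) B (arg v i)) , second (inˡ⊎inʳ (G ⋆) B (img v i))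
      where
      first : (∃[ a ] arg v i ≡ inˡ (G ⋆) B a) ⊎ (∃[ b ] arg v i ≡ inʳ (G ⋆) B b) →
              arg v i ≡ inˡ (G ⋆) B (fromℕ< g<n)
      first (inj₁ (a , eq)) = trans eq (cong (inˡ (G ⋆) B) (Fin.toℕ-injective (trans
        (sym (≡ᵇ⇒≡ g (toℕ a) (T-resp (unary-inˡ (G ⋆) B (suc g) (C∈Star g<n) (∈-Σ² (C∈Star g<n)) a)
          (subst (λ x → T (rel M (suc g , 1) (∈-Σ² (C∈Star g<n)) (x ∷ []))) eq p₂))))
        (sym (Fin.toℕ-fromℕ< g<n)))))
      first (inj₂ (b , eq)) = contradiction
        (subst (λ x → T (rel M (P₁ (Star[ n ] ++ Star[ n ])) P₁∈ (x ∷ []))) eq p₁) (P₁-inʳ (G ⋆) B P₁∈ b)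

      second : (∃[ a ] img v i ≡ inˡ (G ⋆) B a) ⊎ (∃[ b ] img v i ≡ inʳ (G ⋆) B b) →
               ∃[ b ] (img v i ≡ inʳ (G ⋆) B b × T (rel B (suc g , 1) (C∈Star g<n) (b ∷ [])))
      second (inj₁ (a , eq)) = contradiction
        (subst (λ x → T (rel M (P₂ (Star[ n ] ++ Star[ n ])) P₂∈ (x ∷ []))) eq q₁) (P₂-inˡ (G ⋆) B P₂∈ a)
      second (inj₂ (b , eq)) = b , eq , T-resp (unary-inʳ (G ⋆) B (suc g) (C∈Star g<n) (∈-Σ² (C∈Star g<n)) b)
        (subst (λ x → T (rel M (suc g , 1) (∈-Σ² (C∈Star g<n)) (x ∷ []))) eq q₂)

    occupied⁺ : arg v i ≡ inˡ (G ⋆) B (fromℕ< g<n) → ∀ b → img v i ≡ inʳ (G ⋆) B b →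
                T (rel B (suc g , 1) (C∈Star g<n) (b ∷ [])) → Sat M (v ∷ []) (occupied g<n i)
    occupied⁺ p b q r =
      ( subst (λ x → T (rel M (P₁ (Star[ n ] ++ Star[ n ])) P₁∈ (x ∷ []))) (sym p) (P₁-inˡ (G ⋆) B P₁∈ _)
      , subst (λ x → T (rel M (suc g , 1) (∈-Σ² (C∈Star g<n)) (x ∷ []))) (sym p)
          (T-resp (sym (unary-inˡ (G ⋆) B (suc g) (C∈Star g<n) (∈-Σ² (C∈Star g<n)) _))
            (≡⇒≡ᵇ g _ (sym (Fin.toℕ-fromℕ< g<n)))) ) ,
      ( subst (λ x → T (rel M (P₂ (Star[ n ] ++ Star[ n ])) P₂∈ (x ∷ []))) (sym q) (P₂-inʳ (G ⋆) B P₂∈ _)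
      , subst (λ x → T (rel M (suc g , 1) (∈-Σ² (C∈Star g<n)) (x ∷ []))) (sym q)
          (T-resp (sym (unary-inʳ (G ⋆) B (suc g) (C∈Star g<n) (∈-Σ² (C∈Star g<n)) _)) r) )

  -- From a homomorphism G* → B, the vertex h is sent to its restriction to the bag of h.  An
  -- unused slot is filled with a fixed vertex of G.
  forward : (G ⋆ ⟶ B) → (H ⋆ ⟶ B′)
  forward (f , f-hom) = (λ h → untuple z t (order H) M (restrict (toℕ h))) , hom
    where
    default : Fin n
    default = fromℕ< (>-nonZero⁻¹ n)

    vertex : ∀ {g} → Dec (g < n) → Fin n
    vertex (yes g<n) = fromℕ< g<n
    vertex (no _)    = default

    element : ℕ → Fin k → Fin n
    element h i = vertex (t h (toℕ i) <? n)

    restrict : ℕ → Tuple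
    restrict h = tabulate (inˡ (G ⋆) B ∘ element h) Vec.++ tabulate (inʳ (G ⋆) B ∘ f ∘ element h)

    arg-restrict : ∀ h i → arg (restrict h) i ≡ inˡ (G ⋆) B (element h i)
    arg-restrict h i = trans (Vec.lookup-++ˡ (tabulate (inˡ (G ⋆) B ∘ element h)) _ i)
      (Vec.lookup∘tabulate (inˡ (G ⋆) B ∘ element h) i)

    img-restrict : ∀ h i → img (restrict h) i ≡ inʳ (G ⋆) B (f (element h i))
    img-restrict h i = trans (Vec.lookup-++ʳ (tabulate (inˡ (G ⋆) B ∘ element h)) _ i)
      (Vec.lookup∘tabulate (inʳ (G ⋆) B ∘ f ∘ element h) i)

    inˡ-injective : ∀ {a a′} → inˡ (G ⋆) B a ≡ inˡ (G ⋆) B a′ → a ≡ a′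
    inˡ-injective = Fin.↑ˡ-injective (size B) _ _

    restrict-compatible : ∀ h h′ → Compatible (restrict h) (restrict h′)
    restrict-compatible h h′ i j
      rewrite arg-restrict h i | arg-restrict h′ j | img-restrict h i | img-restrict h′ j
      = (λ p → cong (inʳ (G ⋆) B ∘ f) (inˡ-injective p)) ,
        (λ p → T-resp (sym (edgeʳ _ _)) (f-hom E E∈Star (_ ∷ _ ∷ [])
          (T-resp (sym (Bool.∨-identityʳ _)) (T-resp (edgeˡ _ _) p))))

    slot-restrict : ∀ h i → Sat M (restrict h ∷ []) (slot (t h (toℕ i) <? n) i)
    slot-restrict h i with t h (toℕ i) <? n | arg-restrict h i | img-restrict h i
    ... | no _    | _ | _ = refl
    ... | yes g<n | p | q = occupied⁺ g<n (restrict h) i p _ q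
      (f-hom (suc _ , 1) (C∈Star g<n) (fromℕ< g<n ∷ []) (≡⇒≡ᵇ (t h (toℕ i)) _ (sym (Fin.toℕ-fromℕ< g<n))))

    hom′ : ∀ R (R∈ : R ∈ Star[ order H ]) → R ≡ E ⊎ ∃[ h ] (h < order H × R ≡ (suc h , 1)) → ∀ v →
           T (rel (H ⋆) R R∈ v) → T (rel B′ R R∈ (Vec.map (λ h → untuple z t (order H) M (restrict (toℕ h))) v))
    hom′ _ _ (inj₁ refl) (x ∷ y ∷ []) _
      rewrite tuple-untuple z t (order H) M (restrict (toℕ x))
            | tuple-untuple z t (order H) M (restrict (toℕ y))
      = Equivalence.from (sat M (restrict (toℕ x) ∷ restrict (toℕ y) ∷ []) (compatible zero (suc zero)))
          (compatible⁺ (restrict (toℕ x) ∷ restrict (toℕ y) ∷ []) zero (suc zero) (restrict-compatible (toℕ x) (toℕ y)))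
    hom′ _ _ (inj₂ (h , _ , refl)) (x ∷ []) p
      rewrite tuple-untuple z t (order H) M (restrict (toℕ x)) | ≡ᵇ⇒≡ h (toℕ x) p
      = Equivalence.from (sat M (restrict (toℕ x) ∷ []) (bagFormula t (toℕ x)))
          (sat-conj⁺ M (restrict (toℕ x) ∷ []) (allFin k) (slot-restrict (toℕ x))
            (compatible⁺ (restrict (toℕ x) ∷ []) zero zero (restrict-compatible (toℕ x) (toℕ x))))

    hom : ∀ R (R∈ : R ∈ Star[ order H ]) v → _ → _
    hom R R∈ v = hom′ R R∈ (∈-Star R∈) v

  -- Conversely, the partial maps assigned to the vertices of H have a common extension, because
  -- the slots holding a given g are connected in H.
  backward : (H ⋆ ⟶ B′) → (G ⋆ ⟶ B)
  backward (F , F-hom) = f , λ R R∈ → hom R R∈ (∈-Star R∈)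
    where
    partialMap : Fin (order H) → Tuple
    partialMap h = tuple z t (order H) M (F h)

    bag-sat : ∀ h → Sat M (partialMap h ∷ []) (bagFormula t (toℕ h))
    bag-sat h = Equivalence.to (sat M (partialMap h ∷ []) (bagFormula t (toℕ h)))
      (F-hom (suc (toℕ h) , 1) (C∈Star (Fin.toℕ<n h)) (h ∷ []) (≡⇒≡ᵇ (toℕ h) (toℕ h) refl))

    bag-sat′ : ∀ h → (∀ {i} → i ∈ allFin k → Sat M (partialMap h ∷ []) (slot (t (toℕ h) (toℕ i) <? n) i)) ×
                     Sat M (partialMap h ∷ []) (compatible zero zero)
    bag-sat′ h = sat-conj⁻ M (partialMap h ∷ []) {is = allFin k} (bag-sat h)

    -- H has no loops, so the E-formula says nothing about one bag taken twice. The reflexive case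
    -- is the reason why `compatible zero zero` belongs to the bag formula.
    maps-compatible : ∀ {h h′} → ReflE H h h′ → Compatible (partialMap h) (partialMap h′)
    maps-compatible {h} {h′} (inj₁ hh′) = compatible⁻ (partialMap h ∷ partialMap h′ ∷ []) zero (suc zero)
      (Equivalence.to (sat M (partialMap h ∷ partialMap h′ ∷ []) (compatible zero (suc zero)))
        (F-hom E E∈Star (h ∷ h′ ∷ []) (T-resp (sym (Bool.∨-identityʳ _)) hh′)))
    maps-compatible {h} (inj₂ refl) = compatible⁻ (partialMap h ∷ []) zero zero (proj₂ (bag-sat′ h))

    occupied-slot : ∀ (g : Fin n) s → entry s ≡ toℕ g →
      arg (partialMap (proj₁ s)) (proj₂ s) ≡ inˡ (G ⋆) B g ×
      ∃[ b ] (img (partialMap (proj₁ s)) (proj₂ s) ≡ inʳ (G ⋆) B b ×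
              T (rel B (suc (toℕ g) , 1) (C∈Star (Fin.toℕ<n g)) (b ∷ [])))
    occupied-slot g (h , i) eq
      with t (toℕ h) (toℕ i) <? n | proj₁ (bag-sat′ h) (∈-allFin i)
    ... | no ≮n   | _ = contradiction (subst (_< n) (sym eq) (Fin.toℕ<n g)) ≮n
    ... | yes g<n | p with occupied⁻ g<n (partialMap h) i p
    ... | q , b , r , s rewrite eq =
      trans q (cong (inˡ (G ⋆) B) (Fin.fromℕ<-toℕ g g<n)) , b , r , s

    -- Coverage of the reflexive pair (g , g) ensures that g occurs in some bag.
    home : ∀ g → ∃[ s ] entry s ≡ toℕ g
    home g = case cover {g} (inj₂ refl) of λ { (s , _ , _ , p , _) → s , p }

    f : Fin n → Fin (size B)
    f g = proj₁ (proj₂ (occupied-slot g (proj₁ (home g)) (proj₂ (home g))))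

    -- Both ends of a link have the copy of g as argument, so compatibility of the two partial maps
    -- forces equal images.
    img-link : ∀ g {s s′} → Star (Link g) s s′ →
               img (partialMap (proj₁ s)) (proj₂ s) ≡ img (partialMap (proj₁ s′)) (proj₂ s′)
    img-link g ε = refl
    img-link g {s} {s′} (_◅_ {j = s″} (hh′ , p , q) ls) = trans
      (proj₁ (maps-compatible hh′ (proj₂ s) (proj₂ s″))
        (trans (proj₁ (occupied-slot g s p)) (sym (proj₁ (occupied-slot g s″ q)))))
      (img-link g ls)

    img-f : ∀ g s → entry s ≡ toℕ g → img (partialMap (proj₁ s)) (proj₂ s) ≡ inʳ (G ⋆) B (f g)
    img-f g s p = trans (img-link g (connect g p (proj₂ (home g))))
      (proj₁ (proj₂ (proj₂ (occupied-slot g (proj₁ (home g)) (proj₂ (home g))))))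

    hom : ∀ R (R∈ : R ∈ Star[ n ]) → R ≡ E ⊎ ∃[ g ] (g < n × R ≡ (suc g , 1)) → ∀ v →
          T (rel (G ⋆) R R∈ v) → T (rel B R R∈ (Vec.map f v))
    hom _ _ (inj₁ refl) (x ∷ y ∷ []) p with T-resp (Bool.∨-identityʳ (adj G x y)) p
    ... | xy with cover (inj₁ xy)
    ... | s , s′ , hh′ , q , q′ = T-resp (edgeʳ (f x) (f y)) (subst₂ Edge (img-f x s q) (img-f y s′ q′)
      (proj₂ (maps-compatible hh′ (proj₂ s) (proj₂ s′))
        (subst₂ Edge (sym (proj₁ (occupied-slot x s q))) (sym (proj₁ (occupied-slot y s′ q′)))
          (T-resp (sym (edgeˡ x y)) xy))))
    hom _ _ (inj₂ (g , _ , refl)) (x ∷ []) p with ≡ᵇ⇒≡ g (toℕ x) p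
    ... | refl = proj₂ (proj₂ (proj₂ (occupied-slot x (proj₁ (home x)) (proj₂ (home x)))))

-- A structure is determined by its code

encRelation-injective : ∀ {n} k {r r′ : Vec (Fin n) k → Bool} →
                        encRelation k r ≡ encRelation k r′ → ∀ v → r v ≡ r′ v
encRelation-injective zero    p []      = bit-injective p
encRelation-injective (suc k) p (a ∷ v) =
  encRelation-injective k (toList-tabulate-injective (encList-injective p) a) v
  where
  toList-tabulate-injective : ∀ {n} {f g : Fin n → ℕ} →
    Vec.toList (tabulate f) ≡ Vec.toList (tabulate g) → ∀ i → f i ≡ g i
  toList-tabulate-injective p zero    = List.∷-injectiveˡ p
  toList-tabulate-injective p (suc i) = toList-tabulate-injective (List.∷-injectiveʳ p) i

mapWith∈-injective : ∀ {A B : Set} (xs : List A) {f g : ∀ {x} → x ∈ xs → B} →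
                     mapWith∈ xs f ≡ mapWith∈ xs g → ∀ {x} (x∈ : x ∈ xs) → f x∈ ≡ g x∈
mapWith∈-injective (x ∷ xs) p (here refl) = List.∷-injectiveˡ p
mapWith∈-injective (x ∷ xs) p (there x∈)  = mapWith∈-injective xs (List.∷-injectiveʳ p) x∈

-- A yes-instance of the target problem provides some structure with the code of `H ⋆`, not `H ⋆`
-- itself. Equal codes give relations that agree pointwise, which is enough to carry a homomorphism
-- over.
code-⟶ : ∀ {τ} (A A′ {B} : Structure τ) → ⌜ τ , A ⌝ ≡ ⌜ τ , A′ ⌝ → A ⟶ B → A′ ⟶ B
code-⟶ {τ} A A′ {B} p = transport A A′ (proj₁ sizes≡) (proj₂ sizes≡)
  where
  relations : Structure τ → ℕ
  relations A = encList (mapWith∈ τ λ {R} R∈τ → encRelation (arity R) (rel A R R∈τ))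

  sizes≡ : size A ≡ size A′ × relations A ≡ relations A′
  sizes≡ = pair-injective {size A} {relations A} {size A′} {relations A′}
    (proj₂ (pair-injective {encVocabulary τ} {pair (size A) (relations A)}
                           {encVocabulary τ} {pair (size A′) (relations A′)} p))

  transport : ∀ A A′ → size A ≡ size A′ → relations A ≡ relations A′ → A ⟶ B → A′ ⟶ B
  transport record { size = _ } record { size = _ } refl q (f , f-hom) =
    f , λ R R∈τ v r → f-hom R R∈τ v (subst T
      (sym (encRelation-injective (arity R) (mapWith∈-injective τ (encList-injective q) R∈τ) v)) r)

-- From deconstructions to slots

elements : ∀ {n} → Subset n → List ℕ
elements []            = []
elements (inside  ∷ p) = 0 ∷ map suc (elements p)
elements (outside ∷ p) = map suc (elements p)

length-elements : ∀ {n} (p : Subset n) → length (elements p) ≡ ∣ p ∣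
length-elements []            = refl
length-elements (inside  ∷ p) = cong suc (trans (List.length-map suc (elements p)) (length-elements p))
length-elements (outside ∷ p) = trans (List.length-map suc (elements p)) (length-elements p)

∈-elements⁺ : ∀ {n} {x : Fin n} {p} → x Subset.∈ p → toℕ x ∈ elements p
∈-elements⁺ {p = inside  ∷ p} here        = here refl
∈-elements⁺ {p = inside  ∷ p} (there x∈p) = there (∈-map⁺ suc (∈-elements⁺ x∈p))
∈-elements⁺ {p = outside ∷ p} (there x∈p) = ∈-map⁺ suc (∈-elements⁺ x∈p)

∈-elements⁻ : ∀ {n} {x : Fin n} {p} → toℕ x ∈ elements p → x Subset.∈ p
∈-elements⁻ {x = zero}  {inside  ∷ p} _ = here
∈-elements⁻ {x = zero}  {outside ∷ p} q = case ∈-map⁻ suc q of λ { (_ , _ , ()) }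
∈-elements⁻ {x = suc x} {inside  ∷ p} (there q) =
  case ∈-map⁻ suc q of λ { (_ , r , refl) → there (∈-elements⁻ r) }
∈-elements⁻ {x = suc x} {outside ∷ p} q =
  case ∈-map⁻ suc q of λ { (_ , r , refl) → there (∈-elements⁻ r) }

lookupOr : ℕ → List ℕ → ℕ → ℕ
lookupOr d []       i       = d
lookupOr d (x ∷ xs) zero    = x
lookupOr d (x ∷ xs) (suc i) = lookupOr d xs i

lookupOr⁻ : ∀ {d y} xs i → lookupOr d xs i ≡ y → y ≢ d → y ∈ xs
lookupOr⁻ []       i       refl y≢d = contradiction refl y≢d
lookupOr⁻ (x ∷ xs) zero    refl _   = here refl
lookupOr⁻ (x ∷ xs) (suc i) p    y≢d = there (lookupOr⁻ xs i p y≢d)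

lookupOr⁺ : ∀ {d y k xs} → y ∈ xs → length xs ≤ k → ∃[ i ] lookupOr d xs (toℕ {k} i) ≡ y
lookupOr⁺ (here refl) (s≤s _)   = zero , refl
lookupOr⁺ (there y∈)  (s≤s l≤k) = case lookupOr⁺ y∈ l≤k of λ { (i , p) → suc i , p }

-- The reflexive pair (h , h) is among those over which the width is maximised.
∣bag∣≤width : ∀ {H G} (D : Deconstruction H G) h → ∣ bag D h ∣ ≤ width D
∣bag∣≤width {H} D h = ≤-trans (Subset.p⊆q⇒∣p∣≤∣q∣ {p = bag D h} (Subset.p⊆p∪q (bag D h)))
  (All.lookup (xs≤max 0 (map (λ (h , h′) → ∣ bag D h ∪ bag D h′ ∣) edges))
    (∈-map⁺ (λ (h , h′) → ∣ bag D h ∪ bag D h′ ∣)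
      (∈-filter⁺ (reflE? H) (∈-cartesianProduct⁺ (∈-allFin h) (∈-allFin h)) (inj₂ refl))))
  where
  edges = List.filter (reflE? H) (cartesianProduct (allFin (order H)) (allFin (order H)))

ReflE-sym : ∀ {H h h′} → ReflE H h h′ → ReflE H h′ h
ReflE-sym {H} {h} {h′} (inj₁ e) = inj₁ (subst T (Graph.symmetric H h h′) e)
ReflE-sym (inj₂ p)              = inj₂ (sym p)

slots : ∀ {H G k} (D : Deconstruction H G) → width D ≤ k → ∃[ t ] Slots H G k t
slots {H} {G} {k} D w≤k = t , record { cover = cover ; connect = connect }
  where
  m n : ℕ
  m = order H
  n = order G

  entries : ∀ {h} → Dec (h < m) → ℕ → ℕ
  entries (yes h<m) = lookupOr n (elements (bag D (fromℕ< h<m)))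
  entries (no _)    = λ _ → n

  t : ℕ → ℕ → ℕ
  t h = entries (h <? m)

  t-toℕ : ∀ h i → t (toℕ h) i ≡ lookupOr n (elements (bag D h)) i
  t-toℕ h i with toℕ h <? m
  ... | yes h<m = cong (λ h → lookupOr n (elements (bag D h)) i) (Fin.fromℕ<-toℕ h h<m)
  ... | no ≮m   = contradiction (Fin.toℕ<n h) ≮m

  slot⁺ : ∀ {g} h → g Subset.∈ bag D h → ∃[ i ] t (toℕ h) (toℕ {k} i) ≡ toℕ g
  slot⁺ h g∈ = case lookupOr⁺ (∈-elements⁺ g∈)
    (≤-trans (≤-reflexive (length-elements (bag D h))) (≤-trans (∣bag∣≤width D h) w≤k)) of λ
      { (i , p) → i , trans (t-toℕ h (toℕ i)) p }

  slot⁻ : ∀ {g} h i → t (toℕ h) i ≡ toℕ g → g Subset.∈ bag D h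
  slot⁻ {g} h i p = ∈-elements⁻ (lookupOr⁻ (elements (bag D h)) i (trans (sym (t-toℕ h i)) p)
    (<⇒≢ (Fin.toℕ<n g)))

  Slot : Set
  Slot = Fin m × Fin k

  entry : Slot → ℕ
  entry (h , i) = t (toℕ h) (toℕ i)

  cover : ∀ {g g′} → ReflE G g g′ →
          ∃[ s ] ∃[ s′ ] (ReflE H (proj₁ s) (proj₁ s′) × entry s ≡ toℕ g × entry s′ ≡ toℕ g′)
  cover gg′ with coverage D gg′
  ... | h , h′ , hh′ , p , q =
    pick (Subset.x∈p∪q⁻ (bag D h) (bag D h′) p) (Subset.x∈p∪q⁻ (bag D h) (bag D h′) q)
    where
    at : ∀ {g g′} h h′ → ReflE H h h′ → g Subset.∈ bag D h → g′ Subset.∈ bag D h′ →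
         ∃[ s ] ∃[ s′ ] (ReflE H (proj₁ s) (proj₁ s′) × entry s ≡ toℕ g × entry s′ ≡ toℕ g′)
    at h h′ hh′ p q = case slot⁺ h p , slot⁺ h′ q of λ
      { ((i , p′) , (j , q′)) → (h , i) , (h′ , j) , hh′ , p′ , q′ }

    -- If both vertices lie in one bag, the reflexive pair serves; if they lie in the bags in the
    -- opposite order, the edge of H is reversed.
    pick : ∀ {g g′} → g Subset.∈ bag D h ⊎ g Subset.∈ bag D h′ → g′ Subset.∈ bag D h ⊎ g′ Subset.∈ bag D h′ →
           ∃[ s ] ∃[ s′ ] (ReflE H (proj₁ s) (proj₁ s′) × entry s ≡ toℕ g × entry s′ ≡ toℕ g′)
    pick (inj₁ p) (inj₁ q) = at h h (inj₂ refl) p q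
    pick (inj₁ p) (inj₂ q) = at h h′ hh′ p q
    pick (inj₂ p) (inj₁ q) = at h′ h (ReflE-sym {H} hh′) p q
    pick (inj₂ p) (inj₂ q) = at h′ h′ (inj₂ refl) p q

  Link : Fin n → Slot → Slot → Set
  Link g s s′ = ReflE H (proj₁ s) (proj₁ s′) × entry s ≡ toℕ g × entry s′ ≡ toℕ g

  walk : ∀ g {h h′} → Star (λ u v → T (adj H u v) × g Subset.∈ bag D u × g Subset.∈ bag D v) h h′ →
         ∀ i j → entry (h , i) ≡ toℕ g → entry (h′ , j) ≡ toℕ g → Star (Link g) (h , i) (h′ , j)
  -- The path in H is over, but i and j may be different slots of the same bag; a reflexive link
  -- joins them.
  walk g ε                     i j p q = (inj₂ refl , p , q) ◅ ε
  walk g ((e , _ , g∈) ◅ path) i j p q = case slot⁺ _ g∈ of λ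
    { (i′ , r) → (inj₁ e , p , r) ◅ walk g path i′ j r q }

  connect : ∀ g {s s′} → entry s ≡ toℕ g → entry s′ ≡ toℕ g → Star (Link g) s s′
  connect g {h , i} {h′ , j} p q =
    walk g (connectivity D g (slot⁻ h (toℕ i) p) (slot⁻ h′ (toℕ j) q)) i j p q

slots-cong : ∀ {H G k t t′} → (∀ (h : Fin (order H)) (i : Fin k) → t (toℕ h) (toℕ i) ≡ t′ (toℕ h) (toℕ i)) →
             Slots H G k t → Slots H G k t′
slots-cong t≡t′ S = record
  { cover   = λ gg′ → case cover gg′ of λ { (s , s′ , hh′ , p , q) →
      s , s′ , hh′ , trans (sym (t≡t′ _ _)) p , trans (sym (t≡t′ _ _)) q }
  ; connect = λ g p q → Star-map (λ { (hh′ , p , q) → hh′ , trans (sym (t≡t′ _ _)) p , trans (sym (t≡t′ _ _)) q })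
      (connect g (trans (t≡t′ _ _) p) (trans (t≡t′ _ _) q))
  }
  where open Slots S

-- Deciding from codes whether a table of slots is correct

sizeᶜ : ℕ → ℕ
sizeᶜ c = π₁ (π₂ c)

adjᶜ : ℕ → ℕ → ℕ → ℕ
adjᶜ c a b = nth (nth (nth (π₂ (π₂ c)) 0) a) b

sizeᶠ : ∀ {n} → Fn n → Fn n
sizeᶠ c = π₁ᶠ (π₂ᶠ c)

reflEᵗ : ∀ {n} → Fn n → Fn n → Fn n → Test n
reflEᵗ c a b = (nthᶠ (nthᶠ (nthᶠ (π₂ᶠ (π₂ᶠ c)) (lit 0)) a) b ≡ᵗ lit 1) ∨ᵗ (a ≡ᵗ b)

ReflEᶜ : ℕ → ℕ → ℕ → Set
ReflEᶜ c a b = adjᶜ c a b ≡ 1 ⊎ a ≡ b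

-- The relation table of E comes first both in the code of G and in that of `G ⋆`. Thus the same
-- tests read H from its enumerated graph code and G from the parameter, which codes `G ⋆`.
record Represents (c : ℕ) (G : Graph) : Set where
  field
    size≡ : sizeᶜ c ≡ order G
    adj≡  : ∀ x y → adjᶜ c (toℕ x) (toℕ y) ≡ bit (adj G x y)

tail≡ : ∀ v n T rs → π₂ (pair v (pair n (cons T rs))) ≡ pair n (cons T rs)
tail≡ v n T rs = π₂-pair v (pair n (cons T rs))

adjs≡ : ∀ v n T rs → nth (π₂ (π₂ (pair v (pair n (cons T rs))))) 0 ≡ T
adjs≡ v n T rs = trans
  (cong (λ c → nth c 0) (trans (cong π₂ (tail≡ v n T rs)) (π₂-pair n (cons T rs))))
  (π₁-pair T rs)

represents : ∀ v G rs → Represents (pair v (pair (order G) (cons (adjTable G) rs))) G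
represents v G rs = record
  { size≡ = trans (cong π₁ (tail≡ v (order G) (adjTable G) rs)) (π₁-pair (order G) (cons (adjTable G) rs))
  ; adj≡  = λ x y → trans (cong (λ c → nth (nth c (toℕ x)) (toℕ y)) (adjs≡ v (order G) (adjTable G) rs))
      (nth-adjTable G x y)
  }

module _ {c G} (R : Represents c G) where
  open Represents R

  reflE⁺ : ∀ {x y} → ReflE G x y → ReflEᶜ c (toℕ x) (toℕ y)
  reflE⁺ {x} {y} (inj₁ e)    = inj₁ (trans (adj≡ x y) (cong bit (Equivalence.to Bool.T-≡ e)))
  reflE⁺         (inj₂ refl) = inj₂ refl

  reflE⁻ : ∀ {x y} → ReflEᶜ c (toℕ x) (toℕ y) → ReflE G x y
  reflE⁻ {x} {y} (inj₁ e) = inj₁ (Equivalence.from Bool.T-≡ (bit-injective (trans (sym (adj≡ x y)) e)))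
  reflE⁻         (inj₂ p) = inj₂ (Fin.toℕ-injective p)

-- Variables 0 to 3 are the code of H, the table of slots, a bound on the codes of paths of
-- slots and the code of G; w further variables may be bound.
module Context (w : ℕ) where
  Hᶠ tableᶠ boundᶠ Gᶠ : Fn (w + 4)
  Hᶠ     = var (w ↑ʳ v0)
  tableᶠ = var (w ↑ʳ v1)
  boundᶠ = var (w ↑ʳ v2)
  Gᶠ     = var (w ↑ʳ v3)

-- In the innermost scope, variables 5 to 0 are a, b, h, i, h′, j in the notation of `Covers`.
coverᵗ : ℕ → Test 4
coverᵗ k =
  ∀ᵗ (sizeᶠ (Context.Gᶠ 0)) (∀ᵗ (sizeᶠ (Context.Gᶠ 1))
    (reflEᵗ (Context.Gᶠ 2) (var v1) (var v0) ⇒ᵗ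
      ∃ᵗ (sizeᶠ (Context.Hᶠ 2)) (∃ᵗ (lit k) (∃ᵗ (sizeᶠ (Context.Hᶠ 4)) (∃ᵗ (lit k)
        (reflEᵗ Hᶠ (var v3) (var v1) ∧ᵗ
         nthᶠ tableᶠ (pairᶠ (var v3) (var v2)) ≡ᵗ var v5 ∧ᵗ
         nthᶠ tableᶠ (pairᶠ (var v1) (var v0)) ≡ᵗ var v4))))))
  where
  open Context 6

-- Var 0 is the code of a path q₀,…,q_L from the slot (h , i) to the slot (h′ , j), where
-- h, i, h′, j are the variables 4, 3, 2, 1.
pathᵗ : ℕ → Test 9
pathᵗ k =
  nthᶠ q (lit 0) ≡ᵗ pairᶠ (var v4) (var v3) ∧ᵗ
  nthᶠ q (π₁ᶠ (var v0)) ≡ᵗ pairᶠ (var v2) (var v1) ∧ᵗ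
  ∀ᵗ (π₁ᶠ (var v0))
    (reflEᵗ Hᶠ (π₁ᶠ this) (π₁ᶠ next) ∧ᵗ
     π₁ᶠ next <ᵗ sizeᶠ Hᶠ ∧ᵗ
     π₂ᶠ next <ᵗ lit k ∧ᵗ
     nthᶠ tableᶠ this ≡ᵗ nthᶠ tableᶠ next)
  where
  open Context 6
  q = π₂ᶠ (var v0)
  this next : Fn 10
  this = nthᶠ (wk q) (var v0)
  next = nthᶠ (wk q) (sucᶠ (var v0))

-- Only pairs of slots with the same entry below |G| need a path. The bound on its code is part of
-- the certificate, which keeps the quantifier bounded.
connectᵗ : ℕ → Test 4
connectᵗ k =
  ∀ᵗ (sizeᶠ (Context.Hᶠ 0)) (∀ᵗ (lit k) (∀ᵗ (sizeᶠ (Context.Hᶠ 2)) (∀ᵗ (lit k)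
    (nthᶠ tableᶠ (pairᶠ (var v3) (var v2)) ≡ᵗ nthᶠ tableᶠ (pairᶠ (var v1) (var v0)) ∧ᵗ
     nthᶠ tableᶠ (pairᶠ (var v3) (var v2)) <ᵗ sizeᶠ Gᶠ ⇒ᵗ
     ∃ᵗ boundᶠ (pathᵗ k)))))
  where open Context 4

-- This and the next two are `holds` of the tests written out, equal to it by definition. Requiring
-- the bounds only of q (suc s) is enough to decode all entries, since q 0 is the slot x.
Path : ℕ → ℕ → ℕ → ℕ → ℕ → ℕ → (ℕ → ℕ) → Set
Path k H table x y L q =
  q 0 ≡ x × q L ≡ y ×
  (∀ s → s < L → ReflEᶜ H (π₁ (q s)) (π₁ (q (suc s))) ×
                 π₁ (q (suc s)) < sizeᶜ H × π₂ (q (suc s)) < k ×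
                 nth table (q s) ≡ nth table (q (suc s)))

Covers : ℕ → ℕ → ℕ → ℕ → Set
Covers k H table G =
  ∀ a → a < sizeᶜ G → ∀ b → b < sizeᶜ G → ReflEᶜ G a b →
  ∃[ h ] (h < sizeᶜ H × ∃[ i ] (i < k × ∃[ h′ ] (h′ < sizeᶜ H × ∃[ j ] (j < k ×
    (ReflEᶜ H h h′ × nth table (pair h i) ≡ a × nth table (pair h′ j) ≡ b)))))

Connects : ℕ → ℕ → ℕ → ℕ → ℕ → Set
Connects k H table bound G =
  ∀ h → h < sizeᶜ H → ∀ i → i < k → ∀ h′ → h′ < sizeᶜ H → ∀ j → j < k →
  nth table (pair h i) ≡ nth table (pair h′ j) × nth table (pair h i) < sizeᶜ G →
  ∃[ p ] (p < bound × Path k H table (pair h i) (pair h′ j) (π₁ p) (nth (π₂ p)))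

slotsᵗ : ℕ → Test 4
slotsᵗ k = coverᵗ k ∧ᵗ connectᵗ k

-- Translation between slots and certificates

module Certificates {H G : Graph} {cH cG : ℕ} (RH : Represents cH H) (RG : Represents cG G) (k table : ℕ) where

  private
    m n : ℕ
    m = order H
    n = order G

    Slot : Set
    Slot = Fin m × Fin k

    code entry : Slot → ℕ
    code (h , i) = pair (toℕ h) (toℕ i)
    entry s = nth table (code s)

    Link : Fin n → Slot → Slot → Set
    Link g s s′ = ReflE H (proj₁ s) (proj₁ s′) × entry s ≡ toℕ g × entry s′ ≡ toℕ g

    code-injective : ∀ {s s′} → code s ≡ code s′ → s ≡ s′
    code-injective {h , i} {h′ , i′} p = case pair-injective {toℕ h} {toℕ i} {toℕ h′} {toℕ i′} p of λ
      { (q , r) → cong₂ _,_ (Fin.toℕ-injective q) (Fin.toℕ-injective r) }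

    π₁-code : ∀ s → π₁ (code s) ≡ toℕ (proj₁ s)
    π₁-code (h , i) = π₁-pair (toℕ h) (toℕ i)

    π₂-code : ∀ s → π₂ (code s) ≡ toℕ (proj₂ s)
    π₂-code (h , i) = π₂-pair (toℕ h) (toℕ i)

    <sizeH : ∀ (h : Fin m) → toℕ h < sizeᶜ cH
    <sizeH h = subst (toℕ h <_) (sym (Represents.size≡ RH)) (Fin.toℕ<n h)

    <sizeG : ∀ (g : Fin n) → toℕ g < sizeᶜ cG
    <sizeG g = subst (toℕ g <_) (sym (Represents.size≡ RG)) (Fin.toℕ<n g)

    sizeH⁻¹ : ∀ {h} → h < sizeᶜ cH → ∃[ x ] toℕ {m} x ≡ h
    sizeH⁻¹ {h} p = case subst (h <_) (Represents.size≡ RH) p of λ { q → fromℕ< q , Fin.toℕ-fromℕ< q }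

    sizeG⁻¹ : ∀ {g} → g < sizeᶜ cG → ∃[ x ] toℕ {n} x ≡ g
    sizeG⁻¹ {g} p = case subst (g <_) (Represents.size≡ RG) p of λ { q → fromℕ< q , Fin.toℕ-fromℕ< q }

    <k⁻¹ : ∀ {i} → i < k → ∃[ x ] toℕ {k} x ≡ i
    <k⁻¹ q = fromℕ< q , Fin.toℕ-fromℕ< q

    slot⁻¹ : ∀ {c} → π₁ c < sizeᶜ cH → π₂ c < k → ∃[ s ] c ≡ code s
    slot⁻¹ {c} p q = case sizeH⁻¹ p , <k⁻¹ q of λ { ((h , r) , (i , r′)) →
      (h , i) , trans (sym (pair-unpair c)) (sym (cong₂ pair r r′)) }

    path⁻ : ∀ g L q {s s′} → entry s ≡ toℕ g → Path k cH table (code s) (code s′) L q → Star (Link g) s s′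
    path⁻ g zero q {s} {s′} _ (p , p′ , _) =
      subst (Star (Link g) s) (code-injective {s} {s′} (trans (sym p) p′)) ε
    path⁻ g (suc L) q {s} {s′} s≡g (p , p′ , steps) with steps 0 z<s
    ... | e , <m , <k , same with slot⁻¹ <m <k
    ... | s″ , q1≡ = (reflE⁻ RH (subst₂ (ReflEᶜ cH)
                        (trans (cong π₁ p) (π₁-code s)) (trans (cong π₁ q1≡) (π₁-code s″)) e) , s≡g , s″≡g)
                     ◅ path⁻ g L (q ∘ suc) s″≡g (q1≡ , p′ , λ i i<L → steps (suc i) (s<s i<L))
      where
      s″≡g : entry s″ ≡ toℕ g
      s″≡g = trans (cong (nth table) (sym q1≡)) (trans (sym same) (trans (cong (nth table) p) s≡g))

    path⁺ : ∀ g {s s′} → Star (Link g) s s′ → ∃[ L ] ∃[ q ] Path k cH table (code s) (code s′) L q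
    path⁺ g {s} ε = 0 , (λ _ → code s) , refl , refl , λ _ ()
    path⁺ g {s} (_◅_ {j = s″} (e , p , p′) ls) with path⁺ g ls
    ... | L , q , q0 , qL , steps = suc L , q′ , refl , qL , steps′
      where
      q′ : ℕ → ℕ
      q′ zero    = code s
      q′ (suc i) = q i

      steps′ : ∀ i → i < suc L → ReflEᶜ cH (π₁ (q′ i)) (π₁ (q i)) × π₁ (q i) < sizeᶜ cH ×
                                 π₂ (q i) < k × nth table (q′ i) ≡ nth table (q i)
      steps′ zero _ rewrite q0 | π₁-code s | π₁-code s″ | π₂-code s″ =
        reflE⁺ RH e , <sizeH (proj₁ s″) , Fin.toℕ<n (proj₂ s″) , trans p (sym p′)
      steps′ (suc i) (s<s i<L) = steps i i<L

    Path-cong : ∀ {x y} L {q q′} → (∀ i → i ≤ L → q i ≡ q′ i) →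
                Path k cH table x y L q → Path k cH table x y L q′
    Path-cong L q≡q′ (p , p′ , steps) =
      trans (sym (q≡q′ 0 z≤n)) p , trans (sym (q≡q′ L ≤-refl)) p′ ,
      λ i i<L → subst₂
        (λ c c′ → ReflEᶜ cH (π₁ c) (π₁ c′) × π₁ c′ < sizeᶜ cH × π₂ c′ < k × nth table c ≡ nth table c′)
        (q≡q′ i (<⇒≤ i<L)) (q≡q′ (suc i) i<L) (steps i i<L)

    PathCode : ℕ → ℕ → ℕ → Set
    PathCode x y p = Path k cH table x y (π₁ p) (nth (π₂ p))

    pathCode : ∀ {x y} L q → Path k cH table x y L q → ∃[ p ] PathCode x y p
    pathCode {x} {y} L q P = pair L qs , subst₂ (Path k cH table x y)
      (sym (π₁-pair L qs)) (cong nth (sym (π₂-pair L qs)))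
      (Path-cong L {q} (λ i i≤L → sym (nth-applyUpTo q (suc L) (s≤s i≤L))) P)
      where qs = encList (applyUpTo q (suc L))

  sound-slots : ∀ {bound} → Covers k cH table cG → Connects k cH table bound cG →
                Slots H G k (λ h i → nth table (pair h i))
  sound-slots {bound} cov con = record { cover = cover ; connect = connect }
    where
    cover : ∀ {g g′} → ReflE G g g′ →
            ∃[ s ] ∃[ s′ ] (ReflE H (proj₁ s) (proj₁ s′) × entry s ≡ toℕ g × entry s′ ≡ toℕ g′)
    cover {g} {g′} gg′ with cov (toℕ g) (<sizeG g) (toℕ g′) (<sizeG g′) (reflE⁺ RG gg′)
    ... | h , <h , i , <i , h′ , <h′ , j , <j , e , p , p′
      with sizeH⁻¹ <h | <k⁻¹ <i | sizeH⁻¹ <h′ | <k⁻¹ <j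
    ... | h , refl | i , refl | h′ , refl | j , refl = (h , i) , (h′ , j) , reflE⁻ RH e , p , p′

    connect : ∀ g {s s′} → entry s ≡ toℕ g → entry s′ ≡ toℕ g → Star (Link g) s s′
    connect g {h , i} {h′ , j} p p′ with con (toℕ h) (<sizeH h) (toℕ i) (Fin.toℕ<n i)
      (toℕ h′) (<sizeH h′) (toℕ j) (Fin.toℕ<n j) (trans p (sym p′) , subst (_< sizeᶜ cG) (sym p) (<sizeG g))
    ... | c , _ , P = path⁻ g (π₁ c) (nth (π₂ c)) p P

  complete-slots : Slots H G k (λ h i → nth table (pair h i)) →
                   ∃[ bound ] (Covers k cH table cG × Connects k cH table bound cG)
  complete-slots S = proj₁ bounded , covers , connects
    where
    open Slots S using (cover; connect)

    covers : Covers k cH table cG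
    covers a a< b b< ab with sizeG⁻¹ a< | sizeG⁻¹ b<
    ... | g , refl | g′ , refl with cover (reflE⁻ RG ab)
    ... | (h , i) , (h′ , j) , e , p , p′ =
      toℕ h , <sizeH h , toℕ i , Fin.toℕ<n i , toℕ h′ , <sizeH h′ , toℕ j , Fin.toℕ<n j , reflE⁺ RH e , p , p′

    Joined : Slot × Slot → Set
    Joined (s , s′) = entry s ≡ entry s′ × entry s < sizeᶜ cG

    joined? : ∀ ss′ → Dec (Joined ss′)
    joined? (s , s′) = (entry s ≟ entry s′) ×-dec (entry s <? sizeᶜ cG)

    pathOf : ∀ ss′ → Joined ss′ → ∃[ p ] PathCode (code (proj₁ ss′)) (code (proj₂ ss′)) p
    pathOf (s , s′) (same , <n) with sizeG⁻¹ <n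
    ... | g , g≡ with path⁺ g {s} {s′} (connect g {s} {s′} (sym g≡) (trans (sym same) (sym g≡)))
    ... | L , q , P = pathCode {code s} {code s′} L q P

    slotPairs : List (Slot × Slot)
    slotPairs = cartesianProduct all all
      where all = cartesianProduct (allFin m) (allFin k)

    -- There are finitely many pairs of slots, so one number exceeds the codes of the paths chosen
    -- for all joined pairs.
    bound : ∀ ss′s → ∃[ b ] (∀ {ss′} → ss′ ∈ ss′s → Joined ss′ →
                      ∃[ p ] (p < b × PathCode (code (proj₁ ss′)) (code (proj₂ ss′)) p))
    bound [] = 0 , λ ()
    bound (ss′ ∷ ss′s) with bound ss′s | joined? ss′
    ... | b , f | no ¬j = b , λ { (here refl) j → contradiction j ¬j ; (there ss′∈) → f ss′∈ }
    ... | b , f | yes j with pathOf ss′ j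
    ... | p , P = suc p ⊔ b , λ
      { (here refl) _ → p , m≤m⊔n (suc p) b , P
      ; (there ss′∈) j′ → case f ss′∈ j′ of λ { (p′ , <b , P′) → p′ , ≤-trans <b (m≤n⊔m (suc p) b) , P′ } }

    bounded = bound slotPairs

    connects : Connects k cH table (proj₁ bounded) cG
    connects h <h i <i h′ <h′ j <j joined with sizeH⁻¹ <h | <k⁻¹ <i | sizeH⁻¹ <h′ | <k⁻¹ <j
    ... | h , refl | i , refl | h′ , refl | j , refl = proj₂ bounded
      (∈-cartesianProduct⁺ (∈-cartesianProduct⁺ (∈-allFin h) (∈-allFin i))
                           (∈-cartesianProduct⁺ (∈-allFin h′) (∈-allFin j))) joined

pair-mono : ∀ {a b c d} → a ≤ c → b ≤ d → pair a b ≤ pair c d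
pair-mono {b = b} {d = d} a≤c b≤d = +-mono-≤ (triangle-mono (+-mono-≤ a≤c b≤d)) b≤d
  where
  triangle-mono : ∀ {x y} → x ≤ y → triangle x ≤ triangle y
  triangle-mono z≤n       = z≤n
  triangle-mono (s≤s x≤y) = s≤s (+-mono-≤ x≤y (triangle-mono x≤y))

tabulated : ∀ {H G k t} → Slots H G k t → ∃[ table ] Slots H G k (λ h i → nth table (pair h i))
tabulated {H} {G} {k} {t} S = encList (applyUpTo f N) , slots-cong (λ h i → sym (entry≡ h i)) S
  where
  f : ℕ → ℕ
  f c = t (π₁ c) (π₂ c)
  -- By monotonicity of `pair`, every index pair h i in use is at most pair |H| k.
  N = suc (pair (order H) k)

  entry≡ : ∀ (h : Fin (order H)) (i : Fin k) →
           nth (encList (applyUpTo f N)) (pair (toℕ h) (toℕ i)) ≡ t (toℕ h) (toℕ i)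
  entry≡ h i = trans
    (nth-applyUpTo f N (s≤s (pair-mono (<⇒≤ (Fin.toℕ<n h)) (<⇒≤ (Fin.toℕ<n i)))))
    (cong₂ t (π₁-pair (toℕ h) (toℕ i)) (π₂-pair (toℕ h) (toℕ i)))

-- Computing the reduction

-- The inputs are related by an equation because unification cannot invert `pair`. The lemma
-- identifies the enumerated value at an index with the code promised there.
deterministic : ∀ {e x x′ y y′} → e ⟨ x ⟩⇓ y → e ⟨ x′ ⟩⇓ y′ → x ≡ x′ → y ≡ y′
deterministic zero⇓ zero⇓ _ = refl
deterministic succ⇓ succ⇓ p = cong suc p
deterministic (fst⇓ {x} {y}) (fst⇓ {x′} {y′}) p = proj₁ (pair-injective {x} {y} {x′} {y′} p)
deterministic (snd⇓ {x} {y}) (snd⇓ {x′} {y′}) p = proj₂ (pair-injective {x} {y} {x′} {y′} p)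
deterministic (pair⇓ d₁ d₂) (pair⇓ d₁′ d₂′) p =
  cong₂ pair (deterministic d₁ d₁′ p) (deterministic d₂ d₂′ p)
deterministic (comp⇓ d₁ d₂) (comp⇓ d₁′ d₂′) p = deterministic d₂ d₂′ (deterministic d₁ d₁′ p)
deterministic (rec₀⇓ {x = x} d) (rec₀⇓ {x = x′} d′) p =
  deterministic d d′ (proj₁ (pair-injective {x} {0} {x′} {0} p))
deterministic (rec₀⇓ {x = x} _) (recₛ⇓ {x = x′} {n} _ _) p
  with pair-injective {x} {0} {x′} {suc n} p
... | _ , ()
deterministic (recₛ⇓ {x = x} {n} _ _) (rec₀⇓ {x = x′} _) p
  with pair-injective {x} {suc n} {x′} {0} p
... | _ , ()
deterministic (recₛ⇓ {x = x} {n} d₁ d₂) (recₛ⇓ {x = x′} {n′} d₁′ d₂′) p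
  with pair-injective {x} {suc n} {x′} {suc n′} p
... | refl , refl = deterministic d₂ d₂′ (cong (λ y → pair x (pair n y)) (deterministic d₁ d₁′ refl))
deterministic (min⇓ {n = n} d below) (min⇓ {n = n′} d′ below′) refl with <-cmp n n′
... | tri≈ _ n≡n′ _ = n≡n′
... | tri< n<n′ _ _ = case below′ n n<n′ of λ { (_ , d″) → case deterministic d d″ refl of λ () }
... | tri> _ _ n′<n = case below n′ n′<n of λ { (_ , d″) → case deterministic d″ d′ refl of λ () }

fresh-≤ : ∀ τ {b} → (∀ {R} → R ∈ τ → name R < b) → fresh τ ≤ b
fresh-≤ []      p = z≤n
fresh-≤ (R ∷ τ) p = ⊔-lub (p (here refl)) (fresh-≤ τ (p ∘ there))

-- The names in use are 0 for E and 1 to n for the C_a; hence P₁ and P₂ get the names n + 1 and n +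
-- 2.
fresh-Star² : ∀ n → fresh (Star[ n ] ++ Star[ n ]) ≡ suc n
fresh-Star² n = ≤-antisym (fresh-≤ (Star[ n ] ++ Star[ n ]) λ R∈ → [ bound , bound ]′ (∈-++⁻ Star[ n ] R∈)) (lower n)
  where
  bound : ∀ {R} → R ∈ Star[ n ] → name R < suc n
  bound R∈ with ∈-Star R∈
  ... | inj₁ refl             = z<s
  ... | inj₂ (a , a<n , refl) = s<s a<n

  lower : ∀ n → suc n ≤ fresh (Star[ n ] ++ Star[ n ])
  lower zero    = ≤-refl
  lower (suc n) = name<fresh (∈-++⁺ˡ {ys = Star[ suc n ]} (C∈Star (n<1+n n)))

encVocabulary-Σ² : ∀ n {k} (z : Fin k) → encVocabulary (Formulas.Σ² n z) ≡
  starVocabularyCode n (starVocabularyCode n (cons (pair (suc n) 1) (cons (pair (suc (suc n)) 1) 0)))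
encVocabulary-Σ² n z = begin
  encList (map encSymbol ((Star[ n ] ++ Star[ n ]) ++ Ps))
    ≡⟨ cong (encList ∘ map encSymbol) (List.++-assoc Star[ n ] Star[ n ] Ps) ⟩
  encList (map encSymbol (Star[ n ] ++ (Star[ n ] ++ Ps)))
    ≡⟨ cong encList (List.map-++ encSymbol Star[ n ] (Star[ n ] ++ Ps)) ⟩
  encList (map encSymbol Star[ n ] ++ map encSymbol (Star[ n ] ++ Ps))
    ≡⟨ encList-map-Star encSymbol n (map encSymbol (Star[ n ] ++ Ps)) ⟩
  starVocabularyCode n (encList (map encSymbol (Star[ n ] ++ Ps)))
    ≡⟨ cong (starVocabularyCode n ∘ encList) (List.map-++ encSymbol Star[ n ] Ps) ⟩
  starVocabularyCode n (encList (map encSymbol Star[ n ] ++ map encSymbol Ps))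
    ≡⟨ cong (starVocabularyCode n) (encList-map-Star encSymbol n (map encSymbol Ps)) ⟩
  starVocabularyCode n (starVocabularyCode n (encList (map encSymbol Ps)))
    ≡⟨ cong (λ c → starVocabularyCode n (starVocabularyCode n (cons (pair c 1) (cons (pair (suc c) 1) 0))))
         (fresh-Star² n) ⟩
  starVocabularyCode n (starVocabularyCode n (cons (pair (suc n) 1) (cons (pair (suc (suc n)) 1) 0))) ∎
  where
  open ≡-Reasoning
  Ps = P₁ (Star[ n ] ++ Star[ n ]) ∷ P₂ (Star[ n ] ++ Star[ n ]) ∷ []

-- The operations on codes are opaque: unfolding nested codes during conversion is infeasible.
opaque
  notᶜ : ℕ → ℕ
  notᶜ a = pair 2 a

  andᶜ orᶜ eqᶜ atomᶜ : ℕ → ℕ → ℕ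
  andᶜ  a b = pair 3 (pair a b)
  orᶜ   a b = pair 4 (pair a b)
  eqᶜ   a b = pair 1 (pair a b)
  atomᶜ a b = pair 0 (pair a b)

formulaCode : ∀ {σ r w} → Formula σ r w → ℕ
formulaCode (atom R _ xs) = atomᶜ (encSymbol R) (encList (map encVariable (Vec.toList xs)))
formulaCode (x ≐ y)       = eqᶜ (encVariable x) (encVariable y)
formulaCode (¬′ φ)        = notᶜ (formulaCode φ)
formulaCode (φ ∧′ ψ)      = andᶜ (formulaCode φ) (formulaCode ψ)
formulaCode (φ ∨′ ψ)      = orᶜ (formulaCode φ) (formulaCode ψ)

opaque
  unfolding notᶜ

  encFormula≡ : ∀ {σ r w} (φ : Formula σ r w) → encFormula φ ≡ formulaCode φ
  encFormula≡ (atom R x xs) = refl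
  encFormula≡ (x ≐ y)       = refl
  encFormula≡ (¬′ φ)        = cong (pair 2) (encFormula≡ φ)
  encFormula≡ (φ ∧′ ψ)      = cong₂ (λ a b → pair 3 (pair a b)) (encFormula≡ φ) (encFormula≡ ψ)
  encFormula≡ (φ ∨′ ψ)      = cong₂ (λ a b → pair 4 (pair a b)) (encFormula≡ φ) (encFormula≡ ψ)

  and-code : ∀ a b → pair 3 (pair a b) ≡ andᶜ a b
  and-code a b = refl

  atom-code : ∀ a b → pair 0 (pair a b) ≡ atomᶜ a b
  atom-code a b = refl

formulaCode-conj : ∀ {I : Set} {σ r w} (f : I → Formula σ r w) (g : I → ℕ) is {φ c} →
                   (∀ i → formulaCode (f i) ≡ g i) → formulaCode φ ≡ c →
                   formulaCode (conj f is φ) ≡ foldr (λ i c → andᶜ (g i) c) c is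
formulaCode-conj f g []       p q = q
formulaCode-conj f g (i ∷ is) p q = cong₂ andᶜ (p i) (formulaCode-conj f g is p q)

module _ {k : ℕ} (z : Fin k) where
  module F₀ = Formulas 0 z

  -- Only the unary symbols in the formulas depend on n, so the other codes are taken at n = 0.
  code-compatible : ∀ n {r} (a b : Fin (suc r)) →
                    formulaCode (Formulas.compatible n z a b) ≡ formulaCode (F₀.compatible a b)
  code-compatible n a b = trans
    (formulaCode-conj (Formulas.compatibleAt n z a b) (λ ij → formulaCode (F₀.compatibleAt a b ij))
      F₀.pairs (λ ij → refl) refl)
    (sym (formulaCode-conj (F₀.compatibleAt a b) (λ ij → formulaCode (F₀.compatibleAt a b ij))
      F₀.pairs (λ ij → refl) refl))

  unaryCode : ℕ → ℕ → ℕ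
  unaryCode c p = atomᶜ (pair c 1) (cons p 0)

  argumentCode valueCode : Fin k → ℕ
  argumentCode i = encVariable {1} (zero , argument i)
  valueCode    i = encVariable {1} (zero , value i)

  -- A case distinction on whether c is zero, written with `iter` so that it matches `recᶠ` by
  -- computation.
  choose : ℕ → ℕ → ℕ → ℕ
  choose c a b = iter a (λ _ _ → b) c

  occupiedCode : ℕ → ℕ → Fin k → ℕ
  occupiedCode c g i =
    andᶜ (andᶜ (unaryCode c (argumentCode i)) (unaryCode (suc g) (argumentCode i)))
         (andᶜ (unaryCode (suc c) (valueCode i)) (unaryCode (suc g) (valueCode i)))

  slotCode : ℕ → ℕ → Fin k → ℕ
  -- suc g ∸ n vanishes exactly when g < n, that is, when the slot is in use.
  slotCode n g i = choose (suc g ∸ n) (occupiedCode (suc n) g i) (formulaCode (F₀.trivial {0}))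

  bagCode : ℕ → (ℕ → ℕ) → ℕ
  bagCode n g = foldr (λ i c → andᶜ (slotCode n (g (toℕ i)) i) c)
    (formulaCode (F₀.compatible {0} zero zero)) (allFin k)

  interpretationCode : ℕ → ℕ → (ℕ → ℕ → ℕ) → ℕ
  interpretationCode m n t =
    pair (starVocabularyCode m 0)
      (pair (starVocabularyCode n
              (starVocabularyCode n (cons (pair (suc n) 1) (cons (pair (suc (suc n)) 1) 0))))
        (pair (formulaCode (φU I₀)) (pair (formulaCode (φ= I₀))
          (cons (formulaCode (F₀.compatible {1} zero (suc zero))) (tab m (λ h → bagCode n (t h)) 0)))))
    where
    I₀ = F₀.interpretation (λ _ _ → 0) 0

  code-slot : ∀ n {g} (g<? : Dec (g < n)) i → formulaCode (Formulas.slot n z g<? i) ≡ slotCode n g i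
  code-slot n {g} (yes g<n) i = trans (cong (λ c → occupiedCode c g i) (fresh-Star² n))
    (cong (λ c → choose c (occupiedCode (suc n) g i) (formulaCode (F₀.trivial {0}))) (sym (m≤n⇒m∸n≡0 g<n)))
  code-slot n {g} (no ≮n) i with suc g ∸ n in eq
  ... | zero  = contradiction (m∸n≡0⇒m≤n eq) ≮n
  ... | suc _ = refl

  code-interpretation : ∀ m n t →
    encInterpretation (Formulas.interpretation n z t m) ≡ interpretationCode m n t
  code-interpretation m n t = cong₂ pair (encVocabulary-Star m) (cong₂ pair (encVocabulary-Σ² n z)
    (cong₂ pair (encFormula≡ (φU I)) (cong₂ pair (trans (encFormula≡ (φ= I)) code-φ=) (begin
      encList (mapWith∈ Star[ m ] λ {R} R∈ → encFormula (φR I R R∈))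
        ≡⟨ cong encList (mapWith∈-cong Star[ m ] _ (λ {R} _ → table R) (λ R∈ → table≡ _ R∈ (∈-Star R∈))) ⟩
      encList (mapWith∈ Star[ m ] λ {R} _ → table R)
        ≡⟨ cong encList (mapWith∈≗map table Star[ m ]) ⟩
      encList (map table Star[ m ])
        ≡⟨ cong encList (sym (List.++-identityʳ (map table Star[ m ]))) ⟩
      encList (map table Star[ m ] ++ [])
        ≡⟨ encList-map-Star table m [] ⟩
      cons (formulaCode (F₀.compatible {1} zero (suc zero))) (tab m (λ h → bagCode n (t h)) 0) ∎))))
    where
    open ≡-Reasoning
    I = Formulas.interpretation n z t m

    table : Symbol → ℕ
    table (zero  , _) = formulaCode (F₀.compatible {1} zero (suc zero))
    table (suc h , _) = bagCode n (t h)

    code-φ= : formulaCode (φ= I) ≡ formulaCode (φ= (F₀.interpretation (λ _ _ → 0) 0))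
    code-φ= = trans
      (formulaCode-conj (λ j → (zero , j) ≐ (suc zero , j)) equationCode (allFin (k + k)) (λ _ → refl) refl)
      (sym (formulaCode-conj (λ j → (zero , j) ≐ (suc zero , j)) equationCode (allFin (k + k)) (λ _ → refl) refl))
      where
      equationCode : Fin (k + k) → ℕ
      equationCode j = eqᶜ (encVariable {2} (zero , j)) (encVariable {2} (suc zero , j))

    table≡ : ∀ R (R∈ : R ∈ Star[ m ]) → R ≡ E ⊎ ∃[ a ] (a < m × R ≡ (suc a , 1)) →
             encFormula (φR I R R∈) ≡ table R
    table≡ _ _ (inj₁ refl) = trans (encFormula≡ (Formulas.compatible n z zero (suc zero)))
      (code-compatible n zero (suc zero))
    table≡ _ _ (inj₂ (h , _ , refl)) = trans (encFormula≡ (Formulas.bagFormula n z t h))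
      (formulaCode-conj (λ i → Formulas.slot n z (t h (toℕ i) <? n) i)
        (λ i → slotCode n (t h (toℕ i)) i) (allFin k)
        (λ i → code-slot n (t h (toℕ i) <? n) i) (code-compatible n zero zero))

-- Programs for the codes of the expanded graph and of the interpretation

consᶠ andᶠ atomᶠ : ∀ {n} → Fn n → Fn n → Fn n
consᶠ F G = sucᶠ (pairᶠ F G)
andᶠ  F G = pairᶠ (lit 3) (pairᶠ F G) ≗ᶠ (λ ρ → andᶜ (fun F ρ) (fun G ρ)) by λ ρ → and-code _ _
atomᶠ F G = pairᶠ (lit 0) (pairᶠ F G) ≗ᶠ (λ ρ → atomᶜ (fun F ρ) (fun G ρ)) by λ ρ → atom-code _ _

starVocabularyᶠ : ∀ {n} → Fn n → Fn n → Fn n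
starVocabularyᶠ n z = consᶠ (lit (encSymbol E)) (tabᶠ n (pairᶠ (sucᶠ (var v0)) (lit 1)) z)

starᶠ : ∀ {n} → Fn n → Fn n
starᶠ c = pairᶠ (starVocabularyᶠ (sizeᶠ c) (lit 0)) (pairᶠ (sizeᶠ c)
  (consᶠ (nthᶠ (π₂ᶠ (π₂ᶠ c)) (lit 0)) (tabᶠ (sizeᶠ c) (tabᶠ (sizeᶠ (wk c)) equal (lit 0)) (lit 0))))
  where
  equal = lit 1 ∸ᶠ ((var v1 ∸ᶠ var v0) +ᶠ (var v0 ∸ᶠ var v1))

fun-starᶠ : ∀ {n} (c : Fn n) ρ {G} → fun c ρ ≡ ⌜ graphStructure G ⌝ →
            fun (starᶠ c) ρ ≡ ⌜ Star[ order G ] , G ⋆ ⌝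
fun-starᶠ c ρ {G} p = trans
  (cong (λ c → pair (starVocabularyCode (sizeᶜ c) 0) (pair (sizeᶜ c)
    (cons (nth (π₂ (π₂ c)) 0)
          (tab (sizeᶜ c) (λ h → tab (sizeᶜ c) (λ a → 1 ∸ ((h ∸ a) + (a ∸ h))) 0) 0)))) p)
  (trans (cong₂ (λ n adjs → pair (starVocabularyCode n 0) (pair n
      (cons adjs (tab n (λ h → tab n (λ a → 1 ∸ ((h ∸ a) + (a ∸ h))) 0) 0))))
    (Represents.size≡ R) (adjs≡ (encVocabulary (E ∷ [])) (order G) (adjTable G) 0)) (sym (code-star G)))
  where
  R = represents (encVocabulary (E ∷ [])) G 0

module _ {k : ℕ} (z : Fin k) where

  unaryᶠ : ∀ {n} → Fn n → ℕ → Fn n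
  unaryᶠ c p = atomᶠ (pairᶠ c (lit 1)) (consᶠ (lit p) (lit 0))

  slotᶠ : ∀ {n} → Fn n → Fn n → Fin k → Fn n
  slotᶠ n g i = recᶠ (sucᶠ g ∸ᶠ n)
    (andᶠ (andᶠ (unaryᶠ (sucᶠ n) (argumentCode z i)) (unaryᶠ (sucᶠ g) (argumentCode z i)))
          (andᶠ (unaryᶠ (sucᶠ (sucᶠ n)) (valueCode z i)) (unaryᶠ (sucᶠ g) (valueCode z i))))
    (lit (formulaCode (F₀.trivial z {0})))

  -- The conjunction over the k slots is unrolled when the program is built; only n and the entries
  -- are inputs at run time.
  bagᶠ : ∀ {n} → Fn n → (Fin k → Fn n) → Fn n
  bagᶠ n g = foldr (λ i → andᶠ (slotᶠ n (g i) i)) (lit (formulaCode (F₀.compatible z {0} zero zero))) (allFin k)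

  fun-bagᶠ : ∀ {m} (n : Fn m) (g : Fin k → Fn m) (g′ : ℕ → ℕ) ρ → (∀ i → fun (g i) ρ ≡ g′ (toℕ i)) →
             fun (bagᶠ n g) ρ ≡ bagCode z (fun n ρ) g′
  fun-bagᶠ n g g′ ρ p = go (allFin k)
    where
    go : ∀ is → fun (foldr (λ i → andᶠ (slotᶠ n (g i) i)) (lit (formulaCode (F₀.compatible z {0} zero zero))) is) ρ ≡
         foldr (λ i c → andᶜ (slotCode z (fun n ρ) (g′ (toℕ i)) i) c) (formulaCode (F₀.compatible z {0} zero zero)) is
    go []       = refl
    go (i ∷ is) = cong₂ andᶜ (cong (λ x → slotCode z (fun n ρ) x i) (p i)) (go is)

  interpretationᶠ : ∀ {l} → Fn l → Fn l → Fn l → Fn l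
  interpretationᶠ m n table =
    pairᶠ (starVocabularyᶠ m (lit 0))
      (pairᶠ (starVocabularyᶠ n (starVocabularyᶠ n
               (consᶠ (pairᶠ (sucᶠ n) (lit 1)) (consᶠ (pairᶠ (sucᶠ (sucᶠ n)) (lit 1)) (lit 0)))))
        (pairᶠ (lit (formulaCode (φU I₀))) (pairᶠ (lit (formulaCode (φ= I₀)))
          (consᶠ (lit (formulaCode (F₀.compatible z {1} zero (suc zero))))
            (tabᶠ m (bagᶠ (wk n) (λ i → nthᶠ (wk table) (pairᶠ (var v0) (lit (toℕ i))))) (lit 0))))))
    where I₀ = F₀.interpretation z (λ _ _ → 0) 0

  fun-interpretationᶠ : ∀ {l} (m n table : Fn l) ρ → fun (interpretationᶠ m n table) ρ ≡
    interpretationCode z (fun m ρ) (fun n ρ) (λ h i → nth (fun table ρ) (pair h i))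
  fun-interpretationᶠ m n table ρ = cong (λ x →
      pair (starVocabularyCode (fun m ρ) 0)
      (pair (starVocabularyCode (fun n ρ) (starVocabularyCode (fun n ρ)
               (cons (pair (suc (fun n ρ)) 1) (cons (pair (suc (suc (fun n ρ))) 1) 0))))
        (pair (formulaCode (φU I₀)) (pair (formulaCode (φ= I₀))
          (cons (formulaCode (F₀.compatible z {1} zero (suc zero))) x)))))
    (tab-cong (fun m ρ) λ h → fun-bagᶠ (wk n) _ (λ i → nth (fun table ρ) (pair h i)) (h ∷ ρ) λ i → refl)
    where I₀ = F₀.interpretation z (λ _ _ → 0) 0

-- The search for a graph with a certificate

callᵗ : ∀ {m n} → Test m → Vec (Fn n) m → Test n
callᵗ P Fs = record
  { holds    = λ ρ → holds P (Vec.map (λ F → fun F ρ) Fs)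
  ; test     = call (test P) Fs
  ; sound    = λ ρ → sound P _
  ; complete = λ ρ → complete P _
  }

-- The search runs over pairs of an index in the enumeration f of the graph codes, and a
-- certificate for the slots.
module Search (k : ℕ) (z : Fin k) (f : ℕ → ℕ) (e : Prog) (e⇓ : ∀ n → e ⟨ n ⟩⇓ f n) where

  candidateᶠ tableᶠ : Fn 2
  candidateᶠ = after f e e⇓ (π₁ᶠ (var v0))
  tableᶠ     = π₁ᶠ (π₂ᶠ (var v0))

  solves : Test 2
  solves = callᵗ (slotsᵗ k) (candidateᶠ ∷ tableᶠ ∷ π₂ᶠ (π₂ᶠ (var v0)) ∷ var v1 ∷ [])

  -- The input c becomes `env (c ∷ [])`, on which the minimisation runs, and its result l is
  -- appended to give `env (l ∷ c ∷ [])`.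
  solutionᵖ : Prog
  solutionᵖ = compᵖ (pairᵖ idᵖ (minᵖ (prog (test solves)))) (pairᵖ zeroᵖ idᵖ)

  -- Each program repeats the search and obtains the same least solution, so the new parameter and
  -- the interpretation refer to the same graph and table.
  codeᵖ interpretationᵖ : Prog
  codeᵖ           = compᵖ (prog (starᶠ candidateᶠ)) solutionᵖ
  interpretationᵖ = compᵖ (prog (interpretationᶠ z (sizeᶠ candidateᶠ) (sizeᶠ (var v1)) tableᶠ)) solutionᵖ

  graph-represents : ∀ {c} H → c ≡ ⌜ graphStructure H ⌝ → Represents c H
  graph-represents H p = subst (λ c → Represents c H) (sym p) (represents (encVocabulary (E ∷ [])) H 0)

  star-represents : ∀ G → Represents ⌜ Star[ order G ] , G ⋆ ⌝ G
  star-represents G =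
    subst (λ c → Represents c G) (sym (code-star G)) (represents (starVocabularyCode (order G) 0) G _)

  module _ {G : Graph} {c : ℕ} (RG : Represents c G) where

    private
      Certified : ℕ → ℕ → Set
      Certified i ct = Covers k (f i) (π₁ ct) c × Connects k (f i) (π₁ ct) (π₂ ct) c

      certificate : ∀ {H n t} → f n ≡ ⌜ graphStructure H ⌝ → Slots H G k t →
                    ∃[ l ] Certified (π₁ l) (π₂ l)
      certificate {H} {n} fn≡ S = pair n (pair tb bd) ,
        subst₂ Certified (sym (π₁-pair n (pair tb bd))) (sym (π₂-pair n (pair tb bd)))
          (subst₂ (λ t b → Covers k (f n) t c × Connects k (f n) t b c)
            (sym (π₁-pair tb bd)) (sym (π₂-pair tb bd)) (proj₂ certified))
        where
        tb : ℕ
        tb = proj₁ (tabulated S)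

        certified : ∃[ bound ] (Covers k (f n) tb c × Connects k (f n) tb bound c)
        certified = Certificates.complete-slots (graph-represents H fn≡) RG k tb (proj₂ (tabulated S))

        bd : ℕ
        bd = proj₁ certified

    -- The search yields only an index. The fields are therefore stated for any H with the code at
    -- that index, and H is supplied later by the enumeration.
    record Solution : Set where
      field
        index table : ℕ
        sound-table : ∀ {H} → f index ≡ ⌜ graphStructure H ⌝ → Slots H G k (λ h i → nth table (pair h i))
        code⇓       : ∀ {H} → f index ≡ ⌜ graphStructure H ⌝ → codeᵖ ⟨ c ⟩⇓ ⌜ Star[ order H ] , H ⋆ ⌝
        interp⇓     : interpretationᵖ ⟨ c ⟩⇓
                      interpretationCode z (sizeᶜ (f index)) (sizeᶜ c) (λ h i → nth table (pair h i))

    solution : ∀ {H n t} → f n ≡ ⌜ graphStructure H ⌝ → Slots H G k t → Solution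
    solution fn≡ S = fromSearch (proj₁ found) (proj₁ (proj₂ found)) (proj₂ (proj₂ found))
      where
      fromSearch : ∀ l → Certified (π₁ l) (π₂ l) → minᵖ (prog (test solves)) ⟨ pair 0 c ⟩⇓ l → Solution
      fromSearch l (cov , con) l⇓ = record
        { index       = π₁ l
        ; table       = π₁ (π₂ l)
        ; sound-table = λ {H} p → Certificates.sound-slots (graph-represents H p) RG k (π₁ (π₂ l)) cov con
        ; code⇓       = λ {H} p → subst (codeᵖ ⟨ c ⟩⇓_) (fun-starᶠ candidateᶠ (l ∷ c ∷ []) {H} p)
            (comp⇓ solution⇓ (computes (starᶠ candidateᶠ) (l ∷ c ∷ [])))
        ; interp⇓     = subst (interpretationᵖ ⟨ c ⟩⇓_)
            (fun-interpretationᶠ z (sizeᶠ candidateᶠ) (sizeᶠ (var v1)) tableᶠ (l ∷ c ∷ []))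
            (comp⇓ solution⇓ (computes (interpretationᶠ z (sizeᶠ candidateᶠ) (sizeᶠ (var v1)) tableᶠ) (l ∷ c ∷ [])))
        }
        where
        solution⇓ : solutionᵖ ⟨ c ⟩⇓ pair (pair 0 c) l
        solution⇓ = comp⇓ (pair⇓ zero⇓ id⇓) (pair⇓ id⇓ l⇓)

      found : ∃[ l ] (Certified (π₁ l) (π₂ l) × minᵖ (prog (test solves)) ⟨ pair 0 c ⟩⇓ l)
      found = search solves (c ∷ []) (certificate fn≡ S)

theorem5p9 : (𝒢 ℋ : Pred Graph 0ℓ) →
    ComputablyEnumerableGraphs 𝒢 → ComputablyEnumerableGraphs ℋ →
    𝒢 ≼ ℋ →
    p-HOM⟨ (image graphStructure 𝒢) ✶ ⟩≤qfap p-HOM ((image graphStructure ℋ) ✶)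
-- An empty ℋ forces 𝒢 to be empty, since each G would need an H; the programs are then arbitrary.
theorem5p9 𝒢 ℋ _ (inj₁ ℋ-empty) (_ , _ , 𝒢≼ℋ) = 0 , zeroᵖ , zeroᵖ , zeroᵖ , λ
  { _ (_ , (G , G∈𝒢 , _) , _) → case 𝒢≼ℋ G G∈𝒢 of λ
    { (H , H∈ℋ , _) → ⊥-elim (ℋ-empty _ (H , H∈ℋ , refl)) } }
theorem5p9 𝒢 ℋ _ (inj₂ (e , total , onto)) (k , 1≤k , 𝒢≼ℋ) =
  -- The parameter is already the code of the auxiliary structure `G ⋆`, so the program a is the
  -- identity.
  k + k , codeᵖ , idᵖ , interpretationᵖ , reduction
  where
  z : Fin k
  z = fromℕ< 1≤k

  enumerate : ℕ → ℕ
  enumerate n = proj₁ (total n)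

  enumerate⇓ : ∀ n → e ⟨ n ⟩⇓ enumerate n
  enumerate⇓ n = proj₁ (proj₂ (total n))

  open Search k z enumerate e enumerate⇓

  Reduces : ∀ {τ} → Structure τ → Set
  Reduces {τ} A =
    Σ[ c ∈ ℕ ] Σ[ ρ ∈ Vocabulary ] Σ[ P ∈ Structure ρ ]
    Σ[ υ ∈ Vocabulary ] Σ[ I ∈ Interpretation (k + k) υ (pairVocabulary ρ τ) ]
      codeᵖ ⟨ ⌜ τ , A ⌝ ⟩⇓ c ×
      idᵖ ⟨ ⌜ τ , A ⌝ ⟩⇓ ⌜ ρ , P ⌝ ×
      interpretationᵖ ⟨ ⌜ τ , A ⌝ ⟩⇓ encInterpretation I ×
      ((B : Structure τ) →
        Σ[ B′ ∈ Maybe (Structure υ) ]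
          (I ⟪ ⟨ P , B ⟩ ⟫≃ B′ × ((A ⟶ B) ⇔ Yes (p-HOM ((image graphStructure ℋ) ✶)) B′ c)))

  module _ {G : Graph} (S : Solution (star-represents G)) where
    open Solution S

    t : ℕ → ℕ → ℕ
    t h i = nth table (pair h i)

    solution-reduces : ∀ H → ℋ H → enumerate index ≡ ⌜ graphStructure H ⌝ → Reduces (G ⋆)
    solution-reduces H H∈ℋ p =
      ⌜ Star[ order H ] , H ⋆ ⌝ , Star[ order G ] , G ⋆ , Star[ order H ] ,
      Formulas.interpretation (order G) z t (order H) ,
      code⇓ {H} p , id⇓ , subst (interpretationᵖ ⟨ ⌜ Star[ order G ] , G ⋆ ⌝ ⟩⇓_) interpretation≡ interp⇓ ,
      λ B → just (B′ B) , interprets z t (order H) ⟨ G ⋆ , B ⟩ ,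
        mk⇔ (λ h → H ⋆ , (graphStructure H , (H , H∈ℋ , refl) , refl) , refl , forward B h)
            (λ { (A , _ , code≡ , h) → backward B (code-⟶ A (H ⋆) {B′ B} code≡ h) })
      where
      open Reduction {G} {H} z {t} (sound-table {H} p)

      interpretation≡ : interpretationCode z (sizeᶜ (enumerate index)) (sizeᶜ ⌜ Star[ order G ] , G ⋆ ⌝) t ≡
                        encInterpretation (Formulas.interpretation (order G) z t (order H))
      interpretation≡ = trans
        (cong₂ (λ m n → interpretationCode z m n t)
          (Represents.size≡ (graph-represents H p)) (Represents.size≡ (star-represents G)))
        (sym (code-interpretation z (order H) (order G) t))

  reduction : ∀ {τ} (A : Structure τ) → (image graphStructure 𝒢 ✶) (τ , A) → Reduces A
  reduction _ (_ , (G , G∈𝒢 , refl) , refl) = solution-reduces S H H∈ℋ index≡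
    where
    -- `H₀` and its deconstruction witness that the search halts; the reduction uses the graph `H`
    -- at the index actually found.
    H₀ : Graph
    H₀ = proj₁ (𝒢≼ℋ G G∈𝒢)

    H₀∈ℋ : ℋ H₀
    H₀∈ℋ = proj₁ (proj₂ (𝒢≼ℋ G G∈𝒢))

    D : Deconstruction H₀ G
    D = proj₁ (proj₂ (proj₂ (𝒢≼ℋ G G∈𝒢)))

    listed : ∃[ n ] e ⟨ n ⟩⇓ ⌜ graphStructure H₀ ⌝
    listed = onto ⌜ graphStructure H₀ ⌝ (H₀ , H₀∈ℋ , refl)

    S : Solution (star-represents G)
    S = solution (star-represents G) {H₀} {proj₁ listed}
      (deterministic (enumerate⇓ (proj₁ listed)) (proj₂ listed) refl)
      (proj₂ (slots D (proj₂ (proj₂ (proj₂ (𝒢≼ℋ G G∈𝒢))))))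

    found : image (λ G → ⌜ graphStructure G ⌝) ℋ (enumerate (Solution.index S))
    found = proj₂ (proj₂ (total (Solution.index S)))

    H : Graph
    H = proj₁ found

    H∈ℋ : ℋ H
    H∈ℋ = proj₁ (proj₂ found)

    index≡ : enumerate (Solution.index S) ≡ ⌜ graphStructure H ⌝
    index≡ = proj₂ (proj₂ found)
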